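{- $$\mathrm{IC}^{\mathrm{pub}}_{\mu_0^m}(\mathrm{ASCENSION}(m),\delta)\ \ge\ m\times \mathrm{IC}^{\mathrm{mix}}_{\mu_0}(\mathrm{MOUNTAIN},\delta).$$
   Context: $\mathrm I(\cdot:\cdot\,|\,\cdot)$ is conditional (Shannon) mutual information; $[n]=\{1,\ldots,n\}$. Worst-case error at most $\delta$ means that on every input the output is wrong with probability at most $\delta$ over the coins. In both problems messages have length at most a parameter $\mathrm{size}$ (in bits), a function of $m$ and $n$, and the information costs implicitly depend on $\mathrm{size}$. Problem $\mathrm{MOUNTAIN}$: Alice has $X\in\{0,1\}^n$; Bob has $k\in[n]$, a bit $c$, and the prefix $X[1,k-1]$ of $X$. The goal is to compute $f(X,k,c)=X[k]\oplus c$. In a one-pass protocol, Alice sends a message $M_A$ to Bob, Bob sends a message $M_B$ to Alice, then Alice outputs $f(X,k,c)$. In a "mixed" public and private coin randomized protocol, Alice and Bob share public coins $R$, and only Bob has access to extra, independent private coins $R_B$. For a distribution $\nu$ on $(X,k,c)$, $\mathrm{IC}_\nu(P)=\mathrm I(k,c:M_B\,|\,X,R)$, with inputs drawn from $\nu$ and $R$ denoting only the public coins of $P$. $\mathrm{IC}^{\mathrm{mix}}_\nu(\mathrm{MOUNTAIN},\delta)$ is the minimum of $\mathrm{IC}_\nu(P)$ over mixed randomized protocols $P$ for $\mathrm{MOUNTAIN}$ with worst-case error at most $\delta$. Problem $\mathrm{ASCENSION}(m)$: there are $2m$ players $A_1,\ldots,A_m$ and $B_1,\ldots,B_m$. Player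 $A_i$ has $X_i\in\{0,1\}^n$; player $B_i$ has $k_i\in[n]$, a bit $c_i$, and the prefix $X_i[1,k_i-1]$ of $X_i$. With $\mathbf X=(X_1,\ldots,X_m)$, $\mathbf k=(k_1,\ldots,k_m)$, $\mathbf c=(c_1,\ldots,c_m)$, the goal is to compute $f_m(\mathbf X,\mathbf k,\mathbf c)=\bigvee_{i=1}^m(X_i[k_i]\oplus c_i)$. In a one-pass protocol (a format motivated by the streaming model) the communication is in the following order. Round 1: for $i$ from $1$ to $m-1$, $A_i$ sends message $M_{A_i}$ to $B_i$, then $B_i$ sends message $M_{B_i}$ to $A_{i+1}$; then $A_m$ sends message $M_{A_m}$ to $B_m$. Round 2: $B_m$ sends message $M_{B_m}$ to $A_m$; then for $i$ from $m$ down to $2$, $A_i$ sends a message $M'_{A_i}$ to $A_{i-1}$; then $A_1$ computes the output. In a public-coin randomized protocol the only randomness is a string $R$ of public coins shared by all players. For a distribution $\nu$ on $(\mathbf X,\mathbf k,\mathbf c)$, $\mathrm{IC}_\nu(P)=\mathrm I(\mathbf k,\mathbf c:M_{B_m}\,|\,\mathbf X,R)$, with inputs drawn from $\nu$. $\mathrm{IC}^{\mathrm{pub}}_\nu(\mathrm{ASCENSION}(m),\delta)$ is the minimum of $\mathrm{IC}_\nu(P)$ over one-pass public-coin randomized protocols $P$ for the problem with worst-case error at most $\delta$. $\mu_0$ is the distribution of $(X,k,c)$ obtained from uniformly random $X\in\{0,1\}^n$, $k\in[n]$, $c\in\{0,1\}$ by conditioning on $X[k]=c$. Under $\mu_0^m$,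 a distribution over $(\{0,1\}^n\times[n]\times\{0,1\})^m$, the triples $(X_i,k_i,c_i)$, $i=1,\ldots,m$, are independent, each distributed according to $\mu_0$.
   Formalization: Each message depends only on the public coins, the sender's input and the message just received, so M'_{A_i} may not use M_{B_{i-1}} (with such memory the inequality fails); minimum is read as infimum, and coins are finite with rational probabilities. -}

module Defs where

open import Data.Bool.Base using (Bool; true; false; _∨_; _xor_)
import Data.Bool.Properties as Bool
open import Data.Fin.Base using (Fin; zero; suc; toℕ)
import Data.Fin.Properties as Fin
open import Data.Integer.Base using (+_; _⊖_)
open import Data.List.Base as List using (List)
open import Data.List.NonEmpty as List⁺ using (List⁺; _∷_)
open import Data.List.Relation.Unary.Any using (Any; here; there)
open import Data.Nat.Base using (ℕ; zero; suc; NonZero)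
import Data.Nat.Properties as ℕ
open import Data.Product.Base using (Σ; ∃; _×_; _,_)
import Data.Product.Properties as Product
open import Data.Rational.Base
  using (ℚ; 0ℚ; 1ℚ; _/_; _+_; _*_; _<_; _≤_; Positive; +-*-rawSemiring)
open import Data.Rational.Properties using (<-trans; <-dense; normalize-pos)
open import Data.Vec.Base as Vec using (Vec; []; _∷_; lookup)
import Data.Vec.Properties as Vec
open import Data.Vec.Bounded.Base using (Vec≤)
import Data.Vec.Functional as Vector
open import Function.Base using (id; _∘_)
open import Level using (0ℓ)
open import Relation.Binary.Definitions using (DecidableEquality)
open import Relation.Binary.PropositionalEquality using (_≡_; refl)
open import Relation.Nullary using (yes; no)
open import Relation.Nullary.Decidable using (map′; ¬?)
open import Relation.Unary using (Pred; Decidable)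

open import Algebra.Definitions.RawSemiring +-*-rawSemiring using (_^_)

-- Real numbers, as Dedekind lower cuts: x is given by the rationals
-- strictly below it.  The empty cut (−∞) and the
-- full cut (+∞) are allowed, so that infima always exist; the infimum
-- of the empty family is +∞.

record ℝ : Set₁ where
  field
    Below   : Pred ℚ 0ℓ
    lower   : ∀ {p q} → p < q → Below q → Below p
    rounded : ∀ {p} → Below p → ∃ λ q → p < q × Below q

open ℝ public

infix 4 _≤ᵣ_

_≤ᵣ_ : ℝ → ℝ → Set
x ≤ᵣ y = ∀ q → Below x q → Below y q

_≥ᵣ_ : ℝ → ℝ → Set
x ≥ᵣ y = y ≤ᵣ x

infix 4 _≥ᵣ_

sup : Pred ℚ 0ℓ → ℝ
sup S = record
  { Below   = λ q → ∃ λ s → S s × q < s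
  ; lower   = λ { p<q (s , Ss , q<s) → s , Ss , <-trans p<q q<s }
  ; rounded = λ { (s , Ss , p<s) → let (q , p<q , q<s) = <-dense p<s
                                   in q , p<q , s , Ss , q<s }
  }

fromℚ : ℚ → ℝ
fromℚ p = sup (_≡ p)

infixl 6 _+ᵣ_
infixr 7 _·_

_+ᵣ_ : ℝ → ℝ → ℝ
x +ᵣ y = sup λ s → ∃ λ a → ∃ λ b → Below x a × Below y b × s ≡ a + b

_·_ : (w : ℚ) .{{_ : Positive w}} → ℝ → ℝ
w · x = sup λ s → ∃ λ a → Below x a × s ≡ w * a

infixr 7 _×ᵣ_

_×ᵣ_ : (m : ℕ) .{{_ : NonZero m}} → ℝ → ℝ
m ×ᵣ x = _·_ (+ m / 1) {{normalize-pos m 1}} x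

2ℚ : ℚ
2ℚ = 1ℚ + 1ℚ

-- log₂ (p / q) for p, q > 0, as the supremum of the fractions
-- (k − l) / d such that 2^((k − l) / d) ≤ p / q.
log₂[_÷_] : ℚ → ℚ → ℝ
log₂[ p ÷ q ] = sup λ s → ∃ λ k → ∃ λ l → ∃ λ d →
  s ≡ (k ⊖ l) / suc d × 2ℚ ^ k * q ^ suc d ≤ 2ℚ ^ l * p ^ suc d

inf : {I : Set} → (I → ℝ) → ℝ
inf x = sup λ s → ∀ i → Below (x i) s

-- Finite probability distributions with rational probabilities.  The
-- entries of the list are equally likely, and repetitions are allowed:
-- the probability of an outcome is its multiplicity divided by the
-- length of the list.

Dist : Set → Set
Dist = List⁺

Pr : {Ω : Set} → Dist Ω → {E : Pred Ω 0ℓ} → Decidable E → ℚ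
Pr D E? = + List.length (List.filter E? (List⁺.toList D)) / List⁺.length D

𝔼 : {Ω : Set} → Dist Ω → (Ω → ℝ) → ℝ
𝔼 D X = _·_ (+ 1 / List⁺.length D) {{normalize-pos 1 (List⁺.length D)}}
            (List.foldr _+ᵣ_ (fromℚ 0ℚ) (List.map X (List⁺.toList D)))

infixr 6 _⊗_

_⊗_ : {A B : Set} → Dist A → Dist B → Dist (A × B)
D ⊗ E = List⁺.concatMap (λ a → List⁺.map (a ,_) E) D

iid : {A : Set} → Dist A → ∀ m → Dist (Vec A m)
iid D zero    = [] ∷ List.[]
iid D (suc m) = List⁺.map (λ { (a , as) → a ∷ as }) (D ⊗ iid D m)

condition : {Ω : Set} {E : Pred Ω 0ℓ} (D : Dist Ω) → Decidable E →
            Any E (List⁺.toList D) → Dist Ω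
condition {Ω} {E} D E? = go (List⁺.toList D)
  where
  go : (xs : List Ω) → Any E xs → List⁺ Ω
  go (x List.∷ xs) e with E? x | e
  ... | yes _  | _        = x ∷ List.filter E? xs
  ... | no _   | there e′ = go xs e′
  ... | no ¬Ex | here Ex  with () ← ¬Ex Ex

record RV (Ω : Set) : Set₁ where
  constructor rv
  field
    {Value} : Set
    _≟_     : DecidableEquality Value
    value   : Ω → Value

  Same : Ω → Pred Ω 0ℓ
  Same ω ω′ = value ω′ ≡ value ω

  same? : ∀ ω → Decidable (Same ω)
  same? ω ω′ = value ω′ ≟ value ω

infixr 5 _,ᵣ_

_,ᵣ_ : {Ω : Set} → RV Ω → RV Ω → RV Ω
rv _≟₁_ X ,ᵣ rv _≟₂_ Y = rv (Product.≡-dec _≟₁_ _≟₂_) (λ ω → X ω , Y ω)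

-- The expectation of log₂ (p(a,b|c) / (p(a|c) p(b|c))), the fraction
-- being p(a,b,c) p(c) / (p(a,c) p(b,c)).
MutualInfo : {Ω : Set} → Dist Ω → (A B C : RV Ω) → ℝ
MutualInfo D A B C = 𝔼 D λ ω →
  log₂[ p (A ,ᵣ B ,ᵣ C) ω * p C ω ÷ p (A ,ᵣ C) ω * p (B ,ᵣ C) ω ]
  where
  p : (X : RV _) → _ → ℚ
  p X ω = Pr D (RV.same? X ω)

-- (X , k , c); positions are numbered from 0.
Input : ℕ → Set
Input n = Vec Bool n × Fin n × Bool

infix 8 _↾_

-- X ↾ k consists of the entries of X strictly before position k.
_↾_ : {A : Set} {n : ℕ} → Vec A n → (k : Fin n) → Vec A (toℕ k)
(x ∷ X) ↾ zero  = []
(x ∷ X) ↾ suc k = x ∷ X ↾ k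

BobInput : ℕ → Set
BobInput n = Σ (Fin n) λ k → Bool × Vec Bool (toℕ k)

alice : ∀ {n} → Input n → Vec Bool n
alice (X , k , c) = X

bob : ∀ {n} → Input n → BobInput n
bob (X , k , c) = k , c , X ↾ k

index : ∀ {n} → Input n → Fin n
index (X , k , c) = k

bit : ∀ {n} → Input n → Bool
bit (X , k , c) = c

f : ∀ {n} → Input n → Bool
f (X , k , c) = lookup X k xor c

f∨ : ∀ {m n} → Vec (Input n) m → Bool
f∨ = Vec.foldr′ _∨_ false ∘ Vec.map f

Message : ℕ → Set
Message s = Vec≤ Bool s

bits : ∀ {s} → Message s → ∃ (Vec Bool)
bits M = Vec≤.length M , Vec≤.vec M

_≟ᵐ_ : ∀ {s} → DecidableEquality (Message s)
_≟ᵐ_ {s} M M′ = map′ (same M M′) (λ { refl → refl })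
                     (Product.≡-dec ℕ._≟_ (Vec.≡-dec Bool._≟_) (bits M) (bits M′))
  where
  same : (M M′ : Message s) → bits M ≡ bits M′ → M ≡ M′
  same M M′ refl = refl

record MountainProtocol (n s : ℕ) : Set where
  field
    {r r′}       : ℕ
    publicCoins  : Dist (Fin r)
    privateCoins : Dist (Fin r′)
    messageA     : Fin r → Vec Bool n → Message s
    messageB     : Fin r → Fin r′ → BobInput n → Message s → Message s
    -- M_A is determined by the public coins and X, so it is no argument.
    output       : Fin r → Vec Bool n → Message s → Bool

module Mountain {n s : ℕ} (P : MountainProtocol n s) where
  open MountainProtocol P

  Coins : Set
  Coins = Fin r × Fin r′

  M-B : Input n → Coins → Message s
  M-B t (R , R-B) = messageB R R-B (bob t) (messageA R (alice t))

  run : Input n → Coins → Bool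
  run t (R , R-B) = output R (alice t) (M-B t (R , R-B))

  err : Input n → ℚ
  err t = Pr (publicCoins ⊗ privateCoins) (λ R → ¬? (run t R Bool.≟ f t))

  WorstCaseError≤ : ℝ → Set
  WorstCaseError≤ δ = ∀ t → fromℚ (err t) ≤ᵣ δ

  IC : Dist (Input n) → ℝ
  IC ν = MutualInfo (ν ⊗ publicCoins ⊗ privateCoins) (k ,ᵣ c) M (X ,ᵣ R)
    where
    k c M X R : RV (Input n × Coins)
    k = rv Fin._≟_               λ (t , _)     → index t
    c = rv Bool._≟_              λ (t , _)     → bit t
    M = rv _≟ᵐ_                  λ (t , coins) → M-B t coins
    X = rv (Vec.≡-dec Bool._≟_)  λ (t , _)     → alice t
    R = rv Fin._≟_               λ (_ , R , _) → R

-- The coin spaces are arbitrary finite ones, so attainment of the minimum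
-- is not built in: the information cost of the problem is an infimum.
ICmix-MOUNTAIN : (n s : ℕ) → Dist (Input n) → ℝ → ℝ
ICmix-MOUNTAIN n s ν δ =
  inf {Σ (MountainProtocol n s) λ P → Mountain.WorstCaseError≤ P δ}
      λ (P , _) → Mountain.IC P ν

-- ASCENSION (suc m), with pairs of players (A i , B i) for i : Fin (suc m).
--
-- As in a streaming algorithm, a message depends on the public coins, the
-- sender's input and the message just received.  In particular a second
-- round message of A i does not depend on what A i received in the first
-- round.

record AscensionProtocol (m n s : ℕ) : Set where
  field
    {r}         : ℕ
    publicCoins : Dist (Fin r)
    -- Round 1; A zero receives no message before sending one.
    messageA₀   : Fin r → Vec Bool n → Message s
    messageA    : Fin r → Fin m → Vec Bool n → Message s → Message s
    messageB    : Fin r → Fin (suc m) → BobInput n → Message s → Message s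
    -- Round 2; A zero sends no message but computes the output.
    messageA′   : Fin r → Fin m → Vec Bool n → Message s → Message s
    output      : Fin r → Vec Bool n → Message s → Bool
    -- In messageA and messageA′, j : Fin m stands for player A (suc j).

module Ascension {m n s : ℕ} (P : AscensionProtocol m n s) where
  open AscensionProtocol P

  Inputs : Set
  Inputs = Vec (Input n) (suc m)

  -- The message of the last B player, who ends the first round.
  M-B : Inputs → Fin r → Message s
  M-B t R = Vector.foldl step first {m} id
    where
    first : Message s
    first = messageB R zero (bob (lookup t zero))
              (messageA₀ R (alice (lookup t zero)))

    step : Message s → Fin m → Message s
    step M j = messageB R (suc j) (bob (lookup t (suc j)))
                 (messageA R j (alice (lookup t (suc j))) M)

  run : Inputs → Fin r → Bool
  run t R = output R (alice (lookup t zero))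
                     (Vector.foldr step (M-B t R) {m} id)
    where
    step : Fin m → Message s → Message s
    step j M = messageA′ R j (alice (lookup t (suc j))) M

  err : Inputs → ℚ
  err t = Pr publicCoins (λ R → ¬? (run t R Bool.≟ f∨ t))

  WorstCaseError≤ : ℝ → Set
  WorstCaseError≤ δ = ∀ t → fromℚ (err t) ≤ᵣ δ

  IC : Dist Inputs → ℝ
  IC ν = MutualInfo (ν ⊗ publicCoins) (𝐤 ,ᵣ 𝐜) M (𝐗 ,ᵣ R)
    where
    𝐤 𝐜 M 𝐗 R : RV (Inputs × Fin r)
    𝐤 = rv (Vec.≡-dec Fin._≟_)                λ (t , _) → Vec.map index t
    𝐜 = rv (Vec.≡-dec Bool._≟_)               λ (t , _) → Vec.map bit t
    M = rv _≟ᵐ_                               λ (t , R) → M-B t R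
    𝐗 = rv (Vec.≡-dec (Vec.≡-dec Bool._≟_))   λ (t , _) → Vec.map alice t
    R = rv Fin._≟_                            λ (_ , R) → R

ICpub-ASCENSION : (m n s : ℕ) → Dist (Vec (Input n) (suc m)) → ℝ → ℝ
ICpub-ASCENSION m n s ν δ =
  inf {Σ (AscensionProtocol m n s) λ P → Ascension.WorstCaseError≤ P δ}
      λ (P , _) → Ascension.IC P ν

uniformBool : Dist Bool
uniformBool = false ∷ true List.∷ List.[]

uniformFin : ∀ n → Dist (Fin (suc n))
uniformFin n = zero ∷ List.tabulate suc

uniformInput : ∀ n → Dist (Input (suc n))
uniformInput n = iid uniformBool (suc n) ⊗ uniformFin n ⊗ uniformBool

-- The witness is the all-false string with k = 0 and c = false.
μ₀ : ∀ n → Dist (Input (suc n))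
μ₀ n = condition {E = λ (X , k , c) → lookup X k ≡ c} (uniformInput n)
         (λ (X , k , c) → lookup X k Bool.≟ c) (here refl)

{-# OPTIONS --safe #-}

-- By the chain rule, I(𝐤, 𝐜 : M | 𝐗, R) is
-- the sum over j of I(k_j, c_j : M | 𝐗, R, (k_i, c_i) for i < j).  The j-th term is the
-- information cost of a MOUNTAIN protocol which plants its input at pair j,
-- draws R, the inputs of the pairs before j and the strings of the pairs
-- after j publicly, and lets Bob draw the indices of the pairs after j
-- privately.  Under μ₀ the index is independent of the string and c = X[k], so the
-- planted input has the right distribution, and the other pairs contribute
-- nothing to the disjunction, so the error does not grow.
module Submission where

open import Defs
open import Algebra.Bundles using (CommutativeRing)
open import Data.Bool.Base using (Bool; true; false; _∨_; if_then_else_)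
import Data.Bool.Properties as Bool
open import Data.Fin.Base using (Fin; zero; suc; inject₁)
import Data.Fin.Properties as Fin
open import Data.Integer.Base as ℤ using (_⊖_; +_)
import Data.Integer.Properties as ℤ
open import Data.Integer.Solver using (module +-*-Solver)
open import Data.List.Base as List using (List; []; _∷_; _++_; concatMap)
open import Data.List.Membership.Propositional using (_∈_; lose)
open import Data.List.Membership.Propositional.Properties using (∈-filter⁻; ∈-cartesianProduct⁻)
open import Data.List.NonEmpty as List⁺ using (List⁺; _∷_)
import Data.List.Properties as List
open import Data.List.Relation.Binary.Permutation.Propositional as ↭
  using (_↭_; ↭-refl; ↭-trans; ↭-reflexive; module PermutationReasoning)
import Data.List.Relation.Binary.Permutation.Propositional.Properties as ↭
open import Data.List.Relation.Unary.Any using (here; there)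
open import Data.Nat.Base as ℕ using (ℕ; zero; suc)
import Data.Nat.Properties as ℕ
open import Data.Product.Base using (∃; _×_; _,_; proj₁; proj₂; uncurry)
open import Data.Product.Function.NonDependent.Propositional using (_×-↔_)
import Data.Product.Properties as Product
open import Data.Rational.Base
  using (ℚ; 0ℚ; 1ℚ; toℚᵘ; fromℚᵘ; _/_; _+_; _*_; _<_; _≤_; Positive; NonNegative)
open import Data.Rational.Properties
import Data.Rational.Unnormalised.Base as ℚᵘ
import Data.Rational.Unnormalised.Properties as ℚᵘ
open import Data.Sum.Base using (inj₁; inj₂)
open import Data.Unit.Base using (⊤; tt)
open import Data.Vec.Base as Vec using (Vec; []; _∷_; lookup; zipWith)
open import Data.Vec.Bounded.Base as Vec≤ using (Vec≤)
import Data.Vec.Functional as Vector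
import Data.Vec.Properties as Vec
open import Function.Base using (id; _∘_)
open import Function.Bundles using (_⇔_; mk⇔; module Equivalence; _↔_; mk↔ₛ′; module Inverse)
open import Function.Construct.Composition using (_↔-∘_)
open import Function.Construct.Identity using (↔-id)
open import Function.Construct.Symmetry using (↔-sym)
open import Level using (0ℓ)
open import Relation.Binary.Definitions using (DecidableEquality)
open import Relation.Binary.PropositionalEquality
open import Relation.Nullary using (¬_; yes; no; does)
open import Relation.Nullary.Decidable using (¬?)
open import Relation.Nullary.Negation using (contradiction)
open import Relation.Unary using (Pred; Decidable)

open import Algebra.Properties.CommutativeSemigroup
  (CommutativeRing.+-commutativeSemigroup +-*-commutativeRing)
  using () renaming (interchange to +-interchange; x∙yz≈y∙xz to +-left-comm)
open import Algebra.Properties.CommutativeSemigroup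
  (CommutativeRing.*-commutativeSemigroup +-*-commutativeRing)
  using () renaming (interchange to *-interchange)
open import Algebra.Properties.CommutativeSemiring.Exp
  (CommutativeRing.commutativeSemiring +-*-commutativeRing)
  using (_^_; ^-homo-*; ^-assocʳ; ^-distrib-*)
open Equivalence using (to; from)

-- Only one direction of each equality is needed: the terms of the chain rule must sum to at most
-- the cost of ASCENSION. Lower cuts can be added but not subtracted, so the chain rule is proved as
-- an inequality resting on superadditivity of `log₂[_÷_]`. The split of the coins is forced from
-- both sides. Alice plays the pairs before j and the whole second round, so she needs those inputs
-- and every string. Bob's single message must be that of the last B player, so he also plays the
-- pairs after j. The later indices cannot be public, because the j-th term does not condition on
-- them; Bob can draw them alone, since an honest bit is determined by the string and the index. The
-- error of the simulation is an average, over the added coins, of the probabilities that P misses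
-- the planted answer; it is at most that probability for one fixed choice in the support, where the
-- planted answer is the disjunction. Distributions are lists, and the two sides of each
-- identification have equally many entries, so a permutation along a map suffices and no weights
-- need adjusting.

private variable
  A B C Ω Ω′ : Set
  l m n s : ℕ

-- Inequalities between lower cuts

≤ᵣ-refl : ∀ {x} → x ≤ᵣ x
≤ᵣ-refl q = id

≤ᵣ-reflexive : ∀ {x y} → x ≡ y → x ≤ᵣ y
≤ᵣ-reflexive refl q = id

≤ᵣ-trans : ∀ {x y z} → x ≤ᵣ y → y ≤ᵣ z → x ≤ᵣ z
≤ᵣ-trans x≤y y≤z q = y≤z q ∘ x≤y q

-- The cut of a sum holds the rationals strictly below some sum of members; roundedness of `x`
-- supplies the slack.
Below-+ᵣ : ∀ x y {a b} → Below x a → Below y b → Below (x +ᵣ y) (a + b)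
Below-+ᵣ x y {a} {b} xa yb =
  let a′ , a<a′ , xa′ = rounded x xa
  in a′ + b , (a′ , b , xa′ , yb , refl) , +-monoˡ-< b a<a′

+ᵣ-≤ : ∀ {x y z} → (∀ {a b} → Below x a → Below y b → Below z (a + b)) → x +ᵣ y ≤ᵣ z
+ᵣ-≤ {z = z} h q (_ , (a , b , xa , yb , refl) , q<) = lower z q< (h xa yb)

+ᵣ-mono : ∀ {x x′ y y′} → x ≤ᵣ x′ → y ≤ᵣ y′ → x +ᵣ y ≤ᵣ x′ +ᵣ y′
+ᵣ-mono {x} {x′} {y} {y′} x≤ y≤ =
  +ᵣ-≤ {x} {y} {x′ +ᵣ y′} λ xa yb → Below-+ᵣ x′ y′ (x≤ _ xa) (y≤ _ yb)

Below-· : ∀ w .{{_ : Positive w}} {z a} → Below z a → Below (w · z) (w * a)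
Below-· w {z} {a} za =
  let a′ , a<a′ , za′ = rounded z za
  in w * a′ , (a′ , za′ , refl) , *-monoʳ-<-pos w a<a′

·-mono : ∀ w .{{_ : Positive w}} {x y} → x ≤ᵣ y → w · x ≤ᵣ w · y
·-mono w x≤y q (_ , (a , xa , refl) , q<) = _ , (a , x≤y _ xa , refl) , q<

·-distrib-+ᵣ-≤ : ∀ w .{{_ : Positive w}} {x y} → w · x +ᵣ w · y ≤ᵣ w · (x +ᵣ y)
·-distrib-+ᵣ-≤ w {x} {y} = +ᵣ-≤ {w · x} {w · y} {w · (x +ᵣ y)} λ
  { (_ , (a , xa , refl) , p<) (_ , (b , yb , refl) , q<) →
    _ , (a + b , Below-+ᵣ x y xa yb , refl) ,
    subst (_ <_) (sym (*-distribˡ-+ w a b)) (+-mono-< p< q<) }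

fromℚ-mono : ∀ {p q} → p ≤ q → fromℚ p ≤ᵣ fromℚ q
fromℚ-mono p≤q x (_ , refl , x<p) = _ , refl , <-≤-trans x<p p≤q

inf-≤ : ∀ {I : Set} (x : I → ℝ) i → inf x ≤ᵣ x i
inf-≤ x i q (_ , below , q<) = lower (x i) q< (below i)

≤-inf : ∀ {I : Set} {y} (x : I → ℝ) → (∀ i → y ≤ᵣ x i) → y ≤ᵣ inf x
≤-inf {y = y} x y≤ q yq = let q′ , q<q′ , yq′ = rounded y yq in q′ , (λ i → y≤ i q′ yq′) , q<q′

1×ᵣ-≤ : ∀ {x} → 1 ×ᵣ x ≤ᵣ x
1×ᵣ-≤ {x} q (_ , (a , xa , refl) , q<) = lower x (subst (q <_) (*-identityˡ a) q<) xa

suc-/1 : ∀ n → + suc n / 1 ≡ 1ℚ + + n / 1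
suc-/1 n = toℚᵘ-injective (begin
  toℚᵘ (fromℚᵘ (ℚᵘ.mkℚᵘ (+ suc n) 0))                 ≈⟨ toℚᵘ-fromℚᵘ (ℚᵘ.mkℚᵘ (+ suc n) 0) ⟩
  ℚᵘ.mkℚᵘ (+ suc n) 0
    ≈⟨ ℚᵘ.≃-reflexive (cong (λ i → (+ 1 ℤ.+ i) ℚᵘ./ 1) (sym (ℤ.*-identityʳ (+ n)))) ⟩
  ℚᵘ.1ℚᵘ ℚᵘ.+ ℚᵘ.mkℚᵘ (+ n) 0                         ≈⟨ ℚᵘ.+-congʳ ℚᵘ.1ℚᵘ (toℚᵘ-fromℚᵘ (ℚᵘ.mkℚᵘ (+ n) 0)) ⟨
  ℚᵘ.1ℚᵘ ℚᵘ.+ toℚᵘ (fromℚᵘ (ℚᵘ.mkℚᵘ (+ n) 0))         ≈⟨ toℚᵘ-homo-+ 1ℚ (fromℚᵘ (ℚᵘ.mkℚᵘ (+ n) 0)) ⟨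
  toℚᵘ (1ℚ + fromℚᵘ (ℚᵘ.mkℚᵘ (+ n) 0))                ∎)
  where open ℚᵘ.≃-Reasoning

-- One and the same rational below `x` serves in both summands.
suc-×ᵣ-≤ : ∀ n {x} → suc (suc n) ×ᵣ x ≤ᵣ x +ᵣ suc n ×ᵣ x
suc-×ᵣ-≤ n {x} q (_ , (a , xa , refl) , q<) =
  lower (x +ᵣ suc n ×ᵣ x)
    (subst (q <_) (trans (cong (_* a) (suc-/1 (suc n)))
                    (trans (*-distribʳ-+ a 1ℚ (+ suc n / 1))
                      (cong (_+ (+ suc n / 1) * a) (*-identityˡ a)))) q<)
    (Below-+ᵣ x (suc n ×ᵣ x) xa (Below-· (+ suc n / 1) {{normalize-pos (suc n) 1}} {x} xa))

-- Logarithms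

-- The sum is left unreduced, so that it again has the shape that a member of `log₂[_÷_]` must have.
+-common : ∀ k l d k′ l′ d′ →
  (k ⊖ l) / suc d + (k′ ⊖ l′) / suc d′ ≡
  ((k ℕ.* suc d′ ℕ.+ k′ ℕ.* suc d) ⊖ (l ℕ.* suc d′ ℕ.+ l′ ℕ.* suc d)) / (suc d ℕ.* suc d′)
+-common k l d k′ l′ d′ = toℚᵘ-injective (begin
  toℚᵘ (fromℚᵘ a + fromℚᵘ b)              ≈⟨ toℚᵘ-homo-+ (fromℚᵘ a) (fromℚᵘ b) ⟩
  toℚᵘ (fromℚᵘ a) ℚᵘ.+ toℚᵘ (fromℚᵘ b)    ≈⟨ ℚᵘ.+-cong (toℚᵘ-fromℚᵘ a) (toℚᵘ-fromℚᵘ b) ⟩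
  a ℚᵘ.+ b
    ≈⟨ ℚᵘ.≃-reflexive (cong (ℚᵘ._/ (suc d ℕ.* suc d′)) numerators) ⟩
  c                                       ≈⟨ toℚᵘ-fromℚᵘ c ⟨
  toℚᵘ (fromℚᵘ c)                         ∎)
  where
  open ℚᵘ.≃-Reasoning
  a b c : ℚᵘ.ℚᵘ
  a = ℚᵘ.mkℚᵘ (k ⊖ l) d
  b = ℚᵘ.mkℚᵘ (k′ ⊖ l′) d′
  c = ((k ℕ.* suc d′ ℕ.+ k′ ℕ.* suc d) ⊖ (l ℕ.* suc d′ ℕ.+ l′ ℕ.* suc d)) ℚᵘ./ (suc d ℕ.* suc d′)
  difference : ∀ k l e → (k ⊖ l) ℤ.* + e ≡ + (k ℕ.* e) ℤ.- + (l ℕ.* e)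
  difference k l e = trans (cong (ℤ._* + e) (sym (ℤ.m-n≡m⊖n k l)))
    (trans (solve 3 (λ k l e → (k :- l) :* e := k :* e :- l :* e) refl (+ k) (+ l) (+ e))
      (sym (cong₂ ℤ._-_ (ℤ.pos-* k e) (ℤ.pos-* l e))))
    where open +-*-Solver
  numerators : (k ⊖ l) ℤ.* + suc d′ ℤ.+ (k′ ⊖ l′) ℤ.* + suc d ≡
               (k ℕ.* suc d′ ℕ.+ k′ ℕ.* suc d) ⊖ (l ℕ.* suc d′ ℕ.+ l′ ℕ.* suc d)
  numerators = trans (cong₂ ℤ._+_ (difference k l (suc d′)) (difference k′ l′ (suc d)))
    (trans (solve 4 (λ a b a′ b′ → (a :- b) :+ (a′ :- b′) := (a :+ a′) :- (b :+ b′)) refl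
              (+ (k ℕ.* suc d′)) (+ (l ℕ.* suc d′)) (+ (k′ ℕ.* suc d)) (+ (l′ ℕ.* suc d)))
      (ℤ.m-n≡m⊖n (k ℕ.* suc d′ ℕ.+ k′ ℕ.* suc d) (l ℕ.* suc d′ ℕ.+ l′ ℕ.* suc d)))
    where open +-*-Solver

*-mono-≤-nonNeg : ∀ {p q r s} .{{_ : NonNegative r}} .{{_ : NonNegative q}} →
                  p ≤ q → r ≤ s → p * r ≤ q * s
*-mono-≤-nonNeg {p} {q} {r} {s} p≤q r≤s =
  ≤-trans (*-monoʳ-≤-nonNeg r p≤q) (*-monoˡ-≤-nonNeg q r≤s)

^-nonNeg : ∀ p .{{_ : NonNegative p}} n → NonNegative (p ^ n)
^-nonNeg p zero    = _
^-nonNeg p (suc n) = nonNeg*nonNeg⇒nonNeg p (p ^ n) {{^-nonNeg p n}}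

^-pos : ∀ p .{{_ : Positive p}} n → Positive (p ^ n)
^-pos p zero    = _
^-pos p (suc n) = pos*pos⇒pos p (p ^ n) {{^-pos p n}}

^-mono-≤ : ∀ {p q} .{{_ : NonNegative p}} .{{_ : NonNegative q}} → p ≤ q → ∀ n → p ^ n ≤ q ^ n
^-mono-≤ p≤q zero = ≤-refl
^-mono-≤ {p} {q} p≤q (suc n) =
  *-mono-≤-nonNeg {{^-nonNeg p n}} p≤q (^-mono-≤ p≤q n)

-- p / q ≥ 2 ^ ((k − l) / e)
record RatioBound (p q : ℚ) (k l e : ℕ) : Set where
  constructor bound
  field
    unbound : 2ℚ ^ k * q ^ e ≤ 2ℚ ^ l * p ^ e

open RatioBound

2^*^-nonNeg : ∀ k p e .{{_ : NonNegative p}} → NonNegative (2ℚ ^ k * p ^ e)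
2^*^-nonNeg k p e = nonNeg*nonNeg⇒nonNeg (2ℚ ^ k) {{^-nonNeg 2ℚ k}} (p ^ e) {{^-nonNeg p e}}

RatioBound-^ : ∀ {p q k l e} {{_ : NonNegative p}} {{_ : NonNegative q}} →
  RatioBound p q k l e → ∀ n → RatioBound p q (k ℕ.* n) (l ℕ.* n) (e ℕ.* n)
RatioBound-^ {p} {q} {k} {l} {e} (bound h) n =
  bound (subst₂ _≤_ (expand k q) (expand l p)
          (^-mono-≤ {{2^*^-nonNeg k q e}} {{2^*^-nonNeg l p e}} h n))
  where
  expand : ∀ k q → (2ℚ ^ k * q ^ e) ^ n ≡ 2ℚ ^ (k ℕ.* n) * q ^ (e ℕ.* n)
  expand k q = trans (^-distrib-* (2ℚ ^ k) (q ^ e) n) (cong₂ _*_ (^-assocʳ 2ℚ k n) (^-assocʳ q e n))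

RatioBound-* : ∀ {p q p′ q′ k l k′ l′ e}
  {{_ : NonNegative p}} {{_ : NonNegative q′}} →
  RatioBound p q k l e → RatioBound p′ q′ k′ l′ e →
  RatioBound (p * p′) (q * q′) (k ℕ.+ k′) (l ℕ.+ l′) e
RatioBound-* {p} {q} {p′} {q′} {k} {l} {k′} {l′} {e} (bound h) (bound h′) =
  bound (subst₂ _≤_ (collect k q k′ q′) (collect l p l′ p′)
          (*-mono-≤-nonNeg {{2^*^-nonNeg k′ q′ e}} {{2^*^-nonNeg l p e}} h h′))
  where
  collect : ∀ k q k′ q′ → (2ℚ ^ k * q ^ e) * (2ℚ ^ k′ * q′ ^ e) ≡ 2ℚ ^ (k ℕ.+ k′) * (q * q′) ^ e
  collect k q k′ q′ = trans (*-interchange (2ℚ ^ k) (q ^ e) (2ℚ ^ k′) (q′ ^ e))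
    (cong₂ _*_ (sym (^-homo-* 2ℚ k k′)) (sym (^-distrib-* q q′ e)))

-- In the chain rule `r` is the product of the intermediate probabilities, common to numerator and
-- denominator.
RatioBound-cancel : ∀ {p q k l e} r .{{_ : Positive r}} →
  RatioBound (p * r) (q * r) k l e → RatioBound p q k l e
RatioBound-cancel {p} {q} {k} {l} {e} r (bound h) =
  bound (*-cancelʳ-≤-pos (r ^ e) {{^-pos r e}} (subst₂ _≤_ (extract k q) (extract l p) h))
  where
  extract : ∀ k q → 2ℚ ^ k * (q * r) ^ e ≡ 2ℚ ^ k * q ^ e * r ^ e
  extract k q = trans (cong (2ℚ ^ k *_) (^-distrib-* q r e)) (sym (*-assoc (2ℚ ^ k) (q ^ e) (r ^ e)))

-- Raising each bound to the denominator of the other gives a common exponent; then the bounds are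
-- multiplied and `r` is cancelled.
log₂-* : ∀ {p q p′ q′ P Q} r
  {{_ : NonNegative p}} {{_ : NonNegative q}} {{_ : NonNegative p′}} {{_ : NonNegative q′}}
  .{{_ : Positive r}} → p * p′ ≡ P * r → q * q′ ≡ Q * r →
  log₂[ p ÷ q ] +ᵣ log₂[ p′ ÷ q′ ] ≤ᵣ log₂[ P ÷ Q ]
log₂-* {p} {q} {p′} {q′} {P} {Q} r pp′≡Pr qq′≡Qr =
  +ᵣ-≤ {log₂[ p ÷ q ]} {log₂[ p′ ÷ q′ ]} {log₂[ P ÷ Q ]} λ
  { (_ , (k , l , d , refl , h) , a<) (_ , (k′ , l′ , d′ , refl , h′) , b<) →
    -- The third component is the predecessor of `suc d ℕ.* suc d′`, as `log₂[_÷_]` stores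
    -- denominators diminished by one.
    _ , ( k ℕ.* suc d′ ℕ.+ k′ ℕ.* suc d , l ℕ.* suc d′ ℕ.+ l′ ℕ.* suc d , d′ ℕ.+ d ℕ.* suc d′
        , refl , unbound (product k l d k′ l′ d′ (bound h) (bound h′))) ,
    subst (_ <_) (+-common k l d k′ l′ d′) (+-mono-< a< b<) }
  where
  product : ∀ k l d k′ l′ d′ → RatioBound p q k l (suc d) → RatioBound p′ q′ k′ l′ (suc d′) →
    RatioBound P Q (k ℕ.* suc d′ ℕ.+ k′ ℕ.* suc d) (l ℕ.* suc d′ ℕ.+ l′ ℕ.* suc d) (suc d ℕ.* suc d′)
  product k l d k′ l′ d′ h h′ = RatioBound-cancel r
    (subst₂ (λ p q → RatioBound p q _ _ _) pp′≡Pr qq′≡Qr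
      (RatioBound-* (RatioBound-^ h (suc d′))
        (subst (RatioBound p′ q′ _ _) (ℕ.*-comm (suc d′) (suc d)) (RatioBound-^ h′ (suc d)))))

-- Finite sums of cuts

sumᵣ : List ℝ → ℝ
sumᵣ = List.foldr _+ᵣ_ (fromℚ 0ℚ)

∑ : {A : Set} → (A → ℝ) → List A → ℝ
∑ X xs = sumᵣ (List.map X xs)

∑-mono-+ᵣ : ∀ {A : Set} {X Y Z : A → ℝ} xs → (∀ {a} → a ∈ xs → X a +ᵣ Y a ≤ᵣ Z a) →
            ∑ X xs +ᵣ ∑ Y xs ≤ᵣ ∑ Z xs
∑-mono-+ᵣ [] h = +ᵣ-≤ {fromℚ 0ℚ} {fromℚ 0ℚ} {fromℚ 0ℚ} λ
  { (_ , refl , a<0) (_ , refl , b<0) → _ , refl , +-mono-< a<0 b<0 }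
∑-mono-+ᵣ {X = X} {Y} {Z} (x ∷ xs) h = +ᵣ-≤ {∑ X (x ∷ xs)} {∑ Y (x ∷ xs)} {∑ Z (x ∷ xs)} λ
  { (_ , (a , a′ , Xa , Xa′ , refl) , p<) (_ , (b , b′ , Yb , Yb′ , refl) , q<) →
    lower (∑ Z (x ∷ xs)) (subst (_ <_) (+-interchange a a′ b b′) (+-mono-< p< q<))
      (Below-+ᵣ (Z x) (∑ Z xs) (h (here refl) _ (Below-+ᵣ (X x) (Y x) Xa Yb))
        (∑-mono-+ᵣ xs (h ∘ there) _ (Below-+ᵣ (∑ X xs) (∑ Y xs) Xa′ Yb′))) }

sumᵣ-↭ : ∀ {xs ys} → xs ↭ ys → sumᵣ xs ≤ᵣ sumᵣ ys
sumᵣ-↭ {xs} ↭.refl = ≤ᵣ-refl {sumᵣ xs}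
sumᵣ-↭ (↭.prep {xs} {ys} x xs↭ys) =
  +ᵣ-mono {x} {x} {sumᵣ xs} {sumᵣ ys} (≤ᵣ-refl {x}) (sumᵣ-↭ xs↭ys)
sumᵣ-↭ (↭.swap {xs} {ys} x y xs↭ys) =
  +ᵣ-≤ {x} {y +ᵣ sumᵣ xs} {y +ᵣ (x +ᵣ sumᵣ ys)} λ
  { {a} xa (_ , (b , c , yb , sc , refl) , q<) →
    lower (y +ᵣ (x +ᵣ sumᵣ ys)) (subst (_ <_) (+-left-comm a b c) (+-monoʳ-< a q<))
      (Below-+ᵣ y (x +ᵣ sumᵣ ys) yb (Below-+ᵣ x (sumᵣ ys) xa (sumᵣ-↭ xs↭ys _ sc))) }
sumᵣ-↭ (↭.trans p q) = λ r → sumᵣ-↭ q r ∘ sumᵣ-↭ p r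

-- Probabilities and mutual information

-- Stronger than equality of laws: the lists agree as multisets, so their lengths agree too and
-- probabilities are compared by counting alone.
Pushforward : (Ω′ → Ω) → Dist Ω′ → Dist Ω → Set
Pushforward φ D′ D = List.map φ (List⁺.toList D′) ↭ List⁺.toList D

module _ {φ : Ω′ → Ω} {D′ : Dist Ω′} {D : Dist Ω} (push : Pushforward φ D′ D) where

  length-push : List⁺.length D′ ≡ List⁺.length D
  length-push = trans (sym (List.length-map φ (List⁺.toList D′))) (↭.↭-length push)

  module _ {E : Pred Ω 0ℓ} {E′ : Pred Ω′ 0ℓ} (E? : Decidable E) (E′? : Decidable E′)
           (E′⇔E : ∀ ω → E′ ω ⇔ E (φ ω)) where

    length-filter-map : ∀ xs → List.length (List.filter E′? xs) ≡
                               List.length (List.filter E? (List.map φ xs))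
    length-filter-map [] = refl
    length-filter-map (x ∷ xs) with E′? x | E? (φ x)
    ... | yes _   | yes _   = cong suc (length-filter-map xs)
    ... | no _    | no _    = length-filter-map xs
    ... | yes E′x | no ¬Ex  = contradiction (to (E′⇔E x) E′x) ¬Ex
    ... | no ¬E′x | yes Ex  = contradiction (from (E′⇔E x) Ex) ¬E′x

    Pr-push : Pr D′ E′? ≡ Pr D E?
    Pr-push = /-cong
      (cong +_ (trans (length-filter-map (List⁺.toList D′)) (↭.↭-length (↭.filter-↭ E? push))))
      length-push

  𝔼-push : ∀ {X X′} → (∀ ω → X′ ω ≡ X (φ ω)) → 𝔼 D′ X′ ≤ᵣ 𝔼 D X
  𝔼-push {X} {X′} X′≡X = ≤ᵣ-trans {𝔼 D′ X′} {𝔼-list (List⁺.length D′)} {𝔼 D X}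
    (·-mono (+ 1 / List⁺.length D′) {{normalize-pos 1 (List⁺.length D′)}}
            {∑ X′ (List⁺.toList D′)} {∑ X (List⁺.toList D)}
      λ q → sumᵣ-↭ (↭.map⁺ X push) q ∘
            ≤ᵣ-reflexive (cong sumᵣ
              (trans (List.map-cong X′≡X (List⁺.toList D′)) (List.map-∘ (List⁺.toList D′)))) q)
    (≤ᵣ-reflexive (rescale length-push))
    where
    𝔼-list : ∀ n .{{_ : ℕ.NonZero n}} → ℝ
    𝔼-list n = _·_ (+ 1 / n) {{normalize-pos 1 n}} (∑ X (List⁺.toList D))
    rescale : ∀ {m n} .{{_ : ℕ.NonZero m}} .{{_ : ℕ.NonZero n}} → m ≡ n → 𝔼-list m ≡ 𝔼-list n
    rescale refl = refl

infix 4 _≃[_]_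

-- `X′` and `X` after `φ` induce the same partition of the outcomes. Mutual information depends on
-- nothing else, so the two variables may take values in different types.
_≃[_]_ : RV Ω′ → (Ω′ → Ω) → RV Ω → Set
X′ ≃[ φ ] X = ∀ ω ω′ → RV.Same X′ ω ω′ ⇔ RV.Same X (φ ω) (φ ω′)

,ᵣ-cong : ∀ {φ : Ω′ → Ω} {X′ Y′ X Y} → X′ ≃[ φ ] X → Y′ ≃[ φ ] Y → X′ ,ᵣ Y′ ≃[ φ ] X ,ᵣ Y
,ᵣ-cong X≃ Y≃ ω ω′ = mk⇔
  (λ eq → cong₂ _,_ (to (X≃ ω ω′) (cong proj₁ eq)) (to (Y≃ ω ω′) (cong proj₂ eq)))
  (λ eq → cong₂ _,_ (from (X≃ ω ω′) (cong proj₁ eq)) (from (Y≃ ω ω′) (cong proj₂ eq)))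

≃-refl : ∀ {X : RV Ω} → X ≃[ id ] X
≃-refl ω ω′ = mk⇔ id id

≃-value : ∀ (X′ : RV Ω′) (φ : Ω′ → Ω) (d : DecidableEquality (RV.Value X′)) (v : Ω → RV.Value X′) →
          (∀ ω → RV.value X′ ω ≡ v (φ ω)) → X′ ≃[ φ ] rv d v
≃-value X′ φ d v value≡vφ ω ω′ = mk⇔
  (λ eq → trans (sym (value≡vφ ω′)) (trans eq (value≡vφ ω)))
  (λ eq → trans (value≡vφ ω′) (trans eq (sym (value≡vφ ω))))

≃-iso : ∀ {U V : Set} (d : DecidableEquality U) (d′ : DecidableEquality V) {u : Ω → U} {v : Ω → V}
        (g : U → V) (h : V → U) → (∀ ω → g (u ω) ≡ v ω) → (∀ ω → h (v ω) ≡ u ω) →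
        rv d u ≃[ id ] rv d′ v
≃-iso d d′ g h gu hv ω ω′ = mk⇔
  (λ eq → trans (sym (gu ω′)) (trans (cong g eq) (gu ω)))
  (λ eq → trans (sym (hv ω′)) (trans (cong h eq) (hv ω)))

Pushforward-id : (D : Dist Ω) → Pushforward id D D
Pushforward-id D = ↭-reflexive (List.map-id (List⁺.toList D))

𝔼-cong : ∀ (D : Dist Ω) {X Y} → (∀ ω → X ω ≡ Y ω) → 𝔼 D X ≤ᵣ 𝔼 D Y
𝔼-cong D X≡Y = 𝔼-push {D′ = D} {D} (Pushforward-id D) X≡Y

MutualInfo-push : ∀ {φ : Ω′ → Ω} {D′ D} → Pushforward φ D′ D →
  ∀ {A′ B′ C′ A B C} → A′ ≃[ φ ] A → B′ ≃[ φ ] B → C′ ≃[ φ ] C →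
  MutualInfo D′ A′ B′ C′ ≤ᵣ MutualInfo D A B C
MutualInfo-push {φ = φ} {D′} {D} push {A′} {B′} {C′} {A} {B} {C} A≃ B≃ C≃ =
  𝔼-push {D′ = D′} {D} push λ ω → cong₂ log₂[_÷_]
    (cong₂ _*_ (p≡ (A′ ,ᵣ B′ ,ᵣ C′) (A ,ᵣ B ,ᵣ C) ABC≃ ω) (p≡ C′ C C≃ ω))
    (cong₂ _*_ (p≡ (A′ ,ᵣ C′) (A ,ᵣ C) AC≃ ω) (p≡ (B′ ,ᵣ C′) (B ,ᵣ C) BC≃ ω))
  where
  BC≃ : B′ ,ᵣ C′ ≃[ φ ] B ,ᵣ C
  BC≃ = ,ᵣ-cong {X′ = B′} {C′} {B} {C} B≃ C≃
  AC≃ : A′ ,ᵣ C′ ≃[ φ ] A ,ᵣ C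
  AC≃ = ,ᵣ-cong {X′ = A′} {C′} {A} {C} A≃ C≃
  ABC≃ : A′ ,ᵣ B′ ,ᵣ C′ ≃[ φ ] A ,ᵣ B ,ᵣ C
  ABC≃ = ,ᵣ-cong {X′ = A′} {B′ ,ᵣ C′} {A} {B ,ᵣ C} A≃ BC≃
  p≡ : ∀ X′ X → X′ ≃[ φ ] X → ∀ ω → Pr D′ (RV.same? X′ ω) ≡ Pr D (RV.same? X (φ ω))
  p≡ X′ X X≃ ω = Pr-push {D′ = D′} {D} push (RV.same? X (φ ω)) (RV.same? X′ ω) (X≃ ω)

-- The chain rule as an inequality

Pr-pos : ∀ (D : Dist Ω) {E : Pred Ω 0ℓ} (E? : Decidable E) {ω} →
         ω ∈ List⁺.toList D → E ω → Positive (Pr D E?)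
Pr-pos D E? ω∈D Eω = normalize-pos (List.length (List.filter E? (List⁺.toList D))) (List⁺.length D)
  {{_}} {{ℕ.>-nonZero (List.filter-some E? (lose ω∈D Eω))}}

-- Restricted to listed outcomes, since these have the positive probabilities that cancellation
-- inside a logarithm requires.
𝔼-mono-+ᵣ : ∀ (D : Dist Ω) {X Y Z} → (∀ {ω} → ω ∈ List⁺.toList D → X ω +ᵣ Y ω ≤ᵣ Z ω) →
            𝔼 D X +ᵣ 𝔼 D Y ≤ᵣ 𝔼 D Z
𝔼-mono-+ᵣ D {X} {Y} {Z} h q =
  ·-mono w {∑ X xs +ᵣ ∑ Y xs} {∑ Z xs} (∑-mono-+ᵣ xs h) q ∘
  ·-distrib-+ᵣ-≤ w {∑ X xs} {∑ Y xs} q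
  where
  xs = List⁺.toList D
  w = + 1 / List⁺.length D
  instance
    w-pos : Positive w
    w-pos = normalize-pos 1 (List⁺.length D)

-- The ratio for (a : m | c) times the ratio for (b : m | a, c) is the ratio for (a, b : m | c),
-- after cancelling p(a, c) p(a, m, c). The three equations reconcile different orders of the same
-- joint event.
log₂-chain : ∀ {pC pAC pMC pAMC pBAC pBMAC pMAC pABC pABMC} →
  Positive pC → Positive pAC → Positive pMC → Positive pAMC → Positive pBAC → Positive pBMAC →
  pBMAC ≡ pABMC → pBAC ≡ pABC → pMAC ≡ pAMC →
  log₂[ pAMC * pC ÷ pAC * pMC ] +ᵣ log₂[ pBMAC * pAC ÷ pBAC * pMAC ] ≤ᵣ
  log₂[ pABMC * pC ÷ pABC * pMC ]
log₂-chain {pC} {pAC} {pMC} {pAMC} {pBAC} {pBMAC} C+ AC+ MC+ AMC+ BAC+ BMAC+ refl refl refl =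
  log₂-* {pAMC * pC} {pAC * pMC} {pBMAC * pAC} {pBAC * pAMC} {pBMAC * pC} {pBAC * pMC} (pAC * pAMC)
    {{*-nonNeg pAMC pC AMC+ C+}} {{*-nonNeg pAC pMC AC+ MC+}}
    {{*-nonNeg pBMAC pAC BMAC+ AC+}} {{*-nonNeg pBAC pAMC BAC+ AMC+}}
    {{pos*pos⇒pos pAC {{AC+}} pAMC {{AMC+}}}}
    (rearrange pAMC pC pBMAC pAC)
    (trans (rearrange pAC pMC pBAC pAMC) (cong (pBAC * pMC *_) (*-comm pAMC pAC)))
  where
  *-nonNeg : ∀ p q → Positive p → Positive q → NonNegative (p * q)
  *-nonNeg p q p+ q+ = pos⇒nonNeg (p * q) {{pos*pos⇒pos p {{p+}} q {{q+}}}}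
  rearrange : ∀ a b c d → a * b * (c * d) ≡ c * b * (d * a)
  rearrange a b c d = trans (*-comm (a * b) (c * d))
    (trans (cong (c * d *_) (*-comm a b)) (*-interchange c d b a))

MutualInfo-chain₂ : ∀ (D : Dist Ω) A B M C →
  MutualInfo D A M C +ᵣ MutualInfo D B M (A ,ᵣ C) ≤ᵣ MutualInfo D (A ,ᵣ B) M C
MutualInfo-chain₂ D A B M C = 𝔼-mono-+ᵣ D λ {ω} ω∈D →
  let p+ : ∀ X → Positive (p X ω)
      p+ X = Pr-pos D (RV.same? X ω) ω∈D refl
  in log₂-chain
    {p C ω} {p (A ,ᵣ C) ω} {p (M ,ᵣ C) ω} {p (A ,ᵣ M ,ᵣ C) ω}
    {p (B ,ᵣ A ,ᵣ C) ω} {p (B ,ᵣ M ,ᵣ A ,ᵣ C) ω} {p (M ,ᵣ A ,ᵣ C) ω}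
    {p ((A ,ᵣ B) ,ᵣ C) ω} {p ((A ,ᵣ B) ,ᵣ M ,ᵣ C) ω}
    (p+ C) (p+ (A ,ᵣ C)) (p+ (M ,ᵣ C)) (p+ (A ,ᵣ M ,ᵣ C))
    (p+ (B ,ᵣ A ,ᵣ C)) (p+ (B ,ᵣ M ,ᵣ A ,ᵣ C))
    (BMAC ω) (BAC ω) (MAC ω)
  where
  p : RV _ → _ → ℚ
  p X ω = Pr D (RV.same? X ω)
  p≡ : ∀ X Y → X ≃[ id ] Y → ∀ ω → p X ω ≡ p Y ω
  p≡ X Y X≃Y ω = Pr-push {D′ = D} {D} (Pushforward-id D) (RV.same? Y ω) (RV.same? X ω) (X≃Y ω)
  BMAC : ∀ ω → p (B ,ᵣ M ,ᵣ A ,ᵣ C) ω ≡ p ((A ,ᵣ B) ,ᵣ M ,ᵣ C) ω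
  BMAC = p≡ (B ,ᵣ M ,ᵣ A ,ᵣ C) ((A ,ᵣ B) ,ᵣ M ,ᵣ C) λ ω ω′ → mk⇔
    (cong λ (b , m , a , c) → (a , b) , m , c) (cong λ ((a , b) , m , c) → b , m , a , c)
  BAC : ∀ ω → p (B ,ᵣ A ,ᵣ C) ω ≡ p ((A ,ᵣ B) ,ᵣ C) ω
  BAC = p≡ (B ,ᵣ A ,ᵣ C) ((A ,ᵣ B) ,ᵣ C) λ ω ω′ → mk⇔
    (cong λ (b , a , c) → (a , b) , c) (cong λ ((a , b) , c) → b , a , c)
  MAC : ∀ ω → p (M ,ᵣ A ,ᵣ C) ω ≡ p (A ,ᵣ M ,ᵣ C) ω
  MAC = p≡ (M ,ᵣ A ,ᵣ C) (A ,ᵣ M ,ᵣ C) λ ω ω′ → mk⇔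
    (cong λ (m , a , c) → a , m , c) (cong λ (a , m , c) → m , a , c)

tuple : ∀ {l} → (Fin (suc l) → RV Ω) → RV Ω
tuple {l = zero}  A = A zero
tuple {l = suc l} A = A zero ,ᵣ tuple (A ∘ suc)

tuple-Same : ∀ {l} (X : Fin (suc l) → RV Ω) ω ω′ →
             RV.Same (tuple X) ω ω′ ⇔ (∀ j → RV.Same (X j) ω ω′)
tuple-Same {l = zero}  X ω ω′ = mk⇔ (λ { eq zero → eq }) (λ eqs → eqs zero)
tuple-Same {l = suc l} X ω ω′ = mk⇔
  (λ { eq zero → cong proj₁ eq ; eq (suc j) → to (tuple-Same (X ∘ suc) ω ω′) (cong proj₂ eq) j })
  (λ eqs → cong₂ _,_ (eqs zero) (from (tuple-Same (X ∘ suc) ω ω′) (eqs ∘ suc)))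

-- Peeling off `A zero` leaves a tuple conditioned on `A zero ,ᵣ C zero`, which is exchanged for
-- `C (suc zero)`. Asking only for equal partitions lets each `C j` have the form in which the j-th
-- simulation knows it.
MutualInfo-chain : ∀ (D : Dist Ω) M z {l} (A C : Fin (suc l) → RV Ω) →
  (∀ j → A (inject₁ j) ,ᵣ C (inject₁ j) ≃[ id ] C (suc j)) →
  (∀ j → z ≤ᵣ MutualInfo D (A j) M (C j)) →
  suc l ×ᵣ z ≤ᵣ MutualInfo D (tuple A) M (C zero)
MutualInfo-chain D M z {zero}  A C C≃ z≤ q = z≤ zero q ∘ 1×ᵣ-≤ {z} q
MutualInfo-chain D M z {suc l} A C C≃ z≤ q =
  MutualInfo-chain₂ D (A zero) (tuple (A ∘ suc)) M (C zero) q ∘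
  +ᵣ-mono {z} {MutualInfo D (A zero) M (C zero)}
          {suc l ×ᵣ z} {MutualInfo D (tuple (A ∘ suc)) M (A zero ,ᵣ C zero)}
    (z≤ zero)
    (λ r → MutualInfo-push {D′ = D} {D} (Pushforward-id D)
             {tuple (A ∘ suc)} {M} {C (suc zero)} {tuple (A ∘ suc)} {M} {A zero ,ᵣ C zero}
             (≃-refl {X = tuple (A ∘ suc)}) (≃-refl {X = M})
             (λ ω ω′ → mk⇔ (from (C≃ zero ω ω′)) (to (C≃ zero ω ω′))) r ∘
           MutualInfo-chain D M z (A ∘ suc) (C ∘ suc) (C≃ ∘ suc) (z≤ ∘ suc) r) q ∘
  suc-×ᵣ-≤ l {z} q

-- Enumerating distributions

-- Equality of distributions is stated as a permutation of enumerations.  With an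
-- arbitrary continuation f, independent draws can be split, swapped and
-- merged like iterated sums.
infixr 4 _▷_

_▷_ : Dist A → (A → List B) → List B
D ▷ f = concatMap f (List⁺.toList D)

toList-⊗ : ∀ (D : Dist A) (E : Dist B) →
           List⁺.toList (D ⊗ E) ≡ List.cartesianProduct (List⁺.toList D) (List⁺.toList E)
toList-⊗ (x ∷ xs) E = cong (List.map (x ,_) (List⁺.toList E) ++_) (go xs)
  where
  go : ∀ xs → List.concat (List.map List⁺.toList (List.map (λ a → List⁺.map (a ,_) E) xs)) ≡
              List.cartesianProduct xs (List⁺.toList E)
  go []       = refl
  go (x ∷ xs) = cong (List.map (x ,_) (List⁺.toList E) ++_) (go xs)

▷-map : ∀ {C : Set} (D : Dist A) (g : A → B) (f : B → List C) → (List⁺.map g D ▷ f) ≡ (D ▷ f ∘ g)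
▷-map D g f = List.concatMap-map f g (List⁺.toList D)

▷-⊗ : ∀ {C : Set} (D : Dist A) (E : Dist B) (f : A × B → List C) →
      (D ⊗ E ▷ f) ≡ (D ▷ λ a → E ▷ λ b → f (a , b))
▷-⊗ D E f = trans (cong (concatMap f) (toList-⊗ D E)) (go (List⁺.toList D))
  where
  ys = List⁺.toList E
  go : ∀ xs → concatMap f (List.cartesianProduct xs ys) ≡
              concatMap (λ a → concatMap (λ b → f (a , b)) ys) xs
  go []       = refl
  go (x ∷ xs) = trans (List.concatMap-++ f (List.map (x ,_) ys) (List.cartesianProduct xs ys))
    (cong₂ _++_ (List.concatMap-map f (x ,_) ys) (go xs))

▷-cong : ∀ (D : Dist A) {f g : A → List B} → (∀ a → f a ↭ g a) → (D ▷ f) ↭ (D ▷ g)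
▷-cong D {f} {g} f↭g = go (List⁺.toList D)
  where
  go : ∀ xs → concatMap f xs ↭ concatMap g xs
  go []       = ↭-refl
  go (x ∷ xs) = ↭.++⁺ (f↭g x) (go xs)

▷-cong-≡ : ∀ (D : Dist A) {f g : A → List B} → (∀ a → f a ≡ g a) → (D ▷ f) ≡ (D ▷ g)
▷-cong-≡ D f≡g = List.concatMap-cong f≡g (List⁺.toList D)

-- Fubini for enumerations; the entries come in another order, whence a permutation and not an
-- equality.
▷-swap : ∀ {C : Set} (D : Dist A) (E : Dist B) (f : A → B → List C) →
         (D ▷ λ a → E ▷ λ b → f a b) ↭ (E ▷ λ b → D ▷ λ a → f a b)
▷-swap {B = B} {C} D E f = go (List⁺.toList D)
  where
  ys = List⁺.toList E
  merge : ∀ (g h : B → List C) ys →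
          concatMap g ys ++ concatMap h ys ↭ concatMap (λ b → g b ++ h b) ys
  merge g h []       = ↭-refl
  merge g h (y ∷ ys) = begin
    (g y ++ concatMap g ys) ++ (h y ++ concatMap h ys)  ≡⟨ List.++-assoc (g y) (concatMap g ys) _ ⟩
    g y ++ concatMap g ys ++ h y ++ concatMap h ys      ↭⟨ ↭.++⁺ˡ (g y) (↭.shifts (concatMap g ys) (h y)) ⟩
    g y ++ h y ++ concatMap g ys ++ concatMap h ys      ≡⟨ List.++-assoc (g y) (h y) _ ⟨
    (g y ++ h y) ++ concatMap g ys ++ concatMap h ys    ↭⟨ ↭.++⁺ˡ (g y ++ h y) (merge g h ys) ⟩
    (g y ++ h y) ++ concatMap (λ b → g b ++ h b) ys     ∎
    where open PermutationReasoning
  empty : ∀ (ys : List B) → [] ≡ concatMap (λ b → List.[] {A = C}) ys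
  empty []       = refl
  empty (y ∷ ys) = empty ys
  go : ∀ xs → concatMap (λ a → concatMap (f a) ys) xs ↭
              concatMap (λ b → concatMap (λ a → f a b) xs) ys
  go []       = ↭-reflexive (empty ys)
  go (x ∷ xs) = ↭-trans (↭.++⁺ˡ (concatMap (f x) ys) (go xs)) (merge (f x) _ ys)

▷-pushforward : ∀ {φ : Ω′ → Ω} {D′ D} → (D′ ▷ List.[_] ∘ φ) ↭ (D ▷ List.[_]) → Pushforward φ D′ D
▷-pushforward {φ = φ} {D′} {D} h = begin
  List.map φ (List⁺.toList D′)                       ≡⟨ List.concatMap-pure _ ⟨
  concatMap List.[_] (List.map φ (List⁺.toList D′))  ≡⟨ List.concatMap-map List.[_] φ (List⁺.toList D′) ⟩
  (D′ ▷ List.[_] ∘ φ)                                ↭⟨ h ⟩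
  (D ▷ List.[_])                                     ≡⟨ List.concatMap-pure _ ⟩
  List⁺.toList D                                     ∎
  where open PermutationReasoning

▷-iid-suc : ∀ (D : Dist A) m (f : Vec A (suc m) → List B) →
            (iid D (suc m) ▷ f) ≡ (D ▷ λ a → iid D m ▷ λ as → f (a ∷ as))
▷-iid-suc D m f = trans (▷-map (D ⊗ iid D m) _ f) (▷-⊗ D (iid D m) _)

-- The distribution of honest inputs

Honest : Pred (Input n) 0ℓ
Honest (X , k , c) = lookup X k ≡ c

honest? : Decidable (Honest {n})
honest? (X , k , c) = lookup X k Bool.≟ c

agreeing : Vec Bool n → Fin n → Input n
agreeing X k = X , k , lookup X k

-- The first outcome of uniformInput satisfies the condition, so condition
-- computes to a filter.
toList-μ₀ : ∀ n → List⁺.toList (μ₀ n) ≡ List.filter honest? (List⁺.toList (uniformInput n))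
toList-μ₀ n = refl

concatMap-filter : ∀ {E : Pred A 0ℓ} (E? : Decidable E) (f : A → List B) xs →
  concatMap f (List.filter E? xs) ≡ concatMap (λ x → if does (E? x) then f x else []) xs
concatMap-filter E? f [] = refl
concatMap-filter E? f (x ∷ xs) with does (E? x)
... | true  = cong (f x ++_) (concatMap-filter E? f xs)
... | false = concatMap-filter E? f xs

-- Exactly one value of c agrees with X[k], so every pair (X, k) survives the conditioning exactly
-- once: X and k stay independent and uniform.
▷-μ₀ : ∀ n (f : Input (suc n) → List B) →
       (μ₀ n ▷ f) ≡ (iid uniformBool (suc n) ▷ λ X → uniformFin n ▷ λ k → f (agreeing X k))
▷-μ₀ n f = begin
  (μ₀ n ▷ f)
    ≡⟨ cong (concatMap f) (toList-μ₀ n) ⟩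
  concatMap f (List.filter honest? (List⁺.toList (uniformInput n)))
    ≡⟨ concatMap-filter honest? f (List⁺.toList (uniformInput n)) ⟩
  (uniformInput n ▷ f′)
    ≡⟨ ▷-⊗ (iid uniformBool (suc n)) (uniformFin n ⊗ uniformBool) f′ ⟩
  (iid uniformBool (suc n) ▷ λ X → uniformFin n ⊗ uniformBool ▷ λ (k , c) → f′ (X , k , c))
    ≡⟨ ▷-cong-≡ (iid uniformBool (suc n)) (λ X →
         trans (▷-⊗ (uniformFin n) uniformBool (λ (k , c) → f′ (X , k , c)))
           (▷-cong-≡ (uniformFin n) (only X))) ⟩
  (iid uniformBool (suc n) ▷ λ X → uniformFin n ▷ λ k → f (agreeing X k)) ∎
  where
  open ≡-Reasoning
  f′ : Input (suc n) → List _
  f′ t = if does (honest? t) then f t else []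
  only : ∀ X k → (uniformBool ▷ λ c → f′ (X , k , c)) ≡ f (agreeing X k)
  only X k with lookup X k
  ... | false = List.++-identityʳ _
  ... | true  = List.++-identityʳ _

μ₀-honest : ∀ {n t} → t ∈ List⁺.toList (μ₀ n) → Honest t
μ₀-honest {n} {t} t∈ =
  proj₂ (∈-filter⁻ honest? {xs = List⁺.toList (uniformInput n)} (subst (t ∈_) (toList-μ₀ n) t∈))

∈-⊗⁻ : ∀ (D : Dist A) (E : Dist B) {a b} → (a , b) ∈ List⁺.toList (D ⊗ E) →
       a ∈ List⁺.toList D × b ∈ List⁺.toList E
∈-⊗⁻ D E {a} {b} ab∈ =
  ∈-cartesianProduct⁻ (List⁺.toList D) (List⁺.toList E) (subst ((a , b) ∈_) (toList-⊗ D E) ab∈)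

-- Bounding an average by one of its terms

/-mono-≤ : ∀ {a b c d} .{{_ : ℕ.NonZero b}} .{{_ : ℕ.NonZero d}} →
           a ℕ.* d ℕ.≤ c ℕ.* b → + a / b ≤ + c / d
/-mono-≤ {a} {suc b} {c} {suc d} ad≤cb = toℚᵘ-cancel-≤
  (ℚᵘ.≤-respˡ-≃ (ℚᵘ.≃-sym (toℚᵘ-fromℚᵘ (ℚᵘ.mkℚᵘ (+ a) b)))
    (ℚᵘ.≤-respʳ-≃ (ℚᵘ.≃-sym (toℚᵘ-fromℚᵘ (ℚᵘ.mkℚᵘ (+ c) d)))
      (ℚᵘ.*≤* (subst₂ ℤ._≤_ (ℤ.pos-* a (suc d)) (ℤ.pos-* c (suc b)) (ℤ.+≤+ ad≤cb)))))

count : {E : Pred Ω 0ℓ} → Decidable E → Dist Ω → ℕ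
count E? D = List.length (List.filter E? (List⁺.toList D))

Pr-mono-≤ : ∀ (D : Dist Ω) (D′ : Dist Ω′) {E : Pred Ω 0ℓ} {E′ : Pred Ω′ 0ℓ}
            (E? : Decidable E) (E′? : Decidable E′) →
            count E? D ℕ.* List⁺.length D′ ℕ.≤ count E′? D′ ℕ.* List⁺.length D →
            Pr D E? ≤ Pr D′ E′?
Pr-mono-≤ D D′ E? E′? = /-mono-≤ {count E? D} {List⁺.length D} {count E′? D′} {List⁺.length D′}

length-cartesianProduct : ∀ (xs : List A) (ys : List B) →
  List.length (List.cartesianProduct xs ys) ≡ List.length xs ℕ.* List.length ys
length-cartesianProduct []       ys = refl
length-cartesianProduct (x ∷ xs) ys = trans (List.length-++ (List.map (x ,_) ys))
  (cong₂ ℕ._+_ (List.length-map (x ,_) ys) (length-cartesianProduct xs ys))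

module _ {E : Pred (A × B) 0ℓ} (E? : Decidable E) where

  count-map : ∀ x ys → List.length (List.filter E? (List.map (x ,_) ys)) ≡
                       List.length (List.filter (λ y → E? (x , y)) ys)
  count-map x [] = refl
  count-map x (y ∷ ys) with does (E? (x , y))
  ... | true  = cong suc (count-map x ys)
  ... | false = count-map x ys

  count-max : ∀ x xs ys → ∃ λ z → z ∈ x ∷ xs ×
    List.length (List.filter E? (List.cartesianProduct (x ∷ xs) ys)) ℕ.≤
    suc (List.length xs) ℕ.* List.length (List.filter (λ y → E? (z , y)) ys)
  count-max x xs ys = go x xs
    where
    c : A → ℕ
    c z = List.length (List.filter (λ y → E? (z , y)) ys)
    split : ∀ x xs → List.length (List.filter E? (List.cartesianProduct (x ∷ xs) ys)) ≡
                     c x ℕ.+ List.length (List.filter E? (List.cartesianProduct xs ys))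
    split x xs = trans (cong List.length (List.filter-++ E? (List.map (x ,_) ys) _))
      (trans (List.length-++ (List.filter E? (List.map (x ,_) ys))) (cong (ℕ._+ _) (count-map x ys)))
    go : ∀ x xs → ∃ λ z → z ∈ x ∷ xs ×
      List.length (List.filter E? (List.cartesianProduct (x ∷ xs) ys)) ℕ.≤ suc (List.length xs) ℕ.* c z
    go x [] = x , here refl , ℕ.≤-reflexive (split x [])
    go x (x′ ∷ xs) with go x′ xs
    ... | z , z∈ , h with ℕ.≤-total (c x) (c z)
    ...   | inj₁ x≤z = z , there z∈ , ℕ.≤-trans (ℕ.≤-reflexive (split x (x′ ∷ xs))) (ℕ.+-mono-≤ x≤z h)
    ...   | inj₂ z≤x = x , here refl , ℕ.≤-trans (ℕ.≤-reflexive (split x (x′ ∷ xs)))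
              (ℕ.+-monoʳ-≤ (c x) (ℕ.≤-trans h (ℕ.*-monoʳ-≤ (suc (List.length xs)) z≤x)))

  -- The maximiser comes with its membership in `D`, because the inputs that are fixed in this way
  -- must lie in the support to be honest.
  Pr-⊗-≤ : ∀ (D : Dist A) (D′ : Dist B) → ∃ λ a → a ∈ List⁺.toList D ×
           Pr (D ⊗ D′) E? ≤ Pr D′ (λ b → E? (a , b))
  Pr-⊗-≤ D D′ = let z , z∈ , h = count-max (List⁺.head D) (List⁺.tail D) (List⁺.toList D′) in
    z , z∈ , Pr-mono-≤ (D ⊗ D′) D′ E? (λ b → E? (z , b))
      (cross (count E? (D ⊗ D′)) (count (λ b → E? (z , b)) D′)
             (List⁺.length D′) (List⁺.length D) (List⁺.length (D ⊗ D′))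
        (subst (λ xs → List.length (List.filter E? xs) ℕ.≤ List⁺.length D ℕ.* count (λ b → E? (z , b)) D′)
          (sym (toList-⊗ D D′)) h)
        (trans (cong List.length (toList-⊗ D D′))
          (length-cartesianProduct (List⁺.toList D) (List⁺.toList D′))))
    where
    cross : ∀ a c d m N → a ℕ.≤ m ℕ.* c → N ≡ m ℕ.* d → a ℕ.* d ℕ.≤ c ℕ.* N
    cross a c d m N a≤mc refl = begin
      a ℕ.* d          ≤⟨ ℕ.*-monoˡ-≤ d a≤mc ⟩
      m ℕ.* c ℕ.* d    ≡⟨ cong (ℕ._* d) (ℕ.*-comm m c) ⟩
      c ℕ.* m ℕ.* d    ≡⟨ ℕ.*-assoc c m d ⟩
      c ℕ.* (m ℕ.* d)  ∎
      where open ℕ.≤-Reasoning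

-- The simulation

-- Protocols draw their coins from some `Fin r`, while the simulation draws structured tuples; a
-- bijection codes them.
Finite : Set → Set
Finite A = ∃ λ N → A ↔ Fin N

finite-Fin : ∀ n → Finite (Fin n)
finite-Fin n = n , ↔-id _

finite-Bool : Finite Bool
finite-Bool = 2 , ↔-sym Fin.2↔Bool

finite-× : Finite A → Finite B → Finite (A × B)
finite-× (M , f) (N , g) = M ℕ.* N , (↔-sym (Fin.*↔× {M} {N}) ↔-∘ (f ×-↔ g))

finite-Vec : Finite A → ∀ n → Finite (Vec A n)
finite-Vec fin zero    = 1 , mk↔ₛ′ (λ _ → zero) (λ _ → []) (λ { zero → refl }) (λ { [] → refl })
finite-Vec fin (suc n) = let N , f = finite-× fin (finite-Vec fin n) in
  N , (f ↔-∘ mk↔ₛ′ (λ { (x ∷ xs) → x , xs }) (uncurry _∷_) (λ _ → refl) (λ { (x ∷ xs) → refl }))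

finite-Input : ∀ n → Finite (Input n)
finite-Input n = finite-× (finite-Vec finite-Bool n) (finite-× (finite-Fin n) finite-Bool)

-- The coins of the simulation of pair j: publicly, the inputs of the pairs
-- before j and the strings of the pairs after j; privately, the indices of
-- the pairs after j.
Public : ℕ → Fin (suc m) → Set
Public {m}     n zero    = Vec (Vec Bool n) m
Public {suc m} n (suc j) = Input n × Public n j

Private : ℕ → Fin (suc m) → Set
Private {m}     n zero    = Vec (Fin n) m
Private {suc m} n (suc j) = Private n j

finite-Public : ∀ n (j : Fin (suc m)) → Finite (Public n j)
finite-Public {m}     n zero    = finite-Vec (finite-Vec finite-Bool n) m
finite-Public {suc m} n (suc j) = finite-× (finite-Input n) (finite-Public n j)

finite-Private : ∀ n (j : Fin (suc m)) → Finite (Private n j)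
finite-Private {m}     n zero    = finite-Vec (finite-Fin n) m
finite-Private {suc m} n (suc j) = finite-Private n j

fill : (j : Fin (suc m)) → Public n j → Private n j → Input n → Vec (Input n) (suc m)
fill         zero    Xs      ks t = t ∷ zipWith agreeing Xs ks
fill {suc m} (suc j) (u , p) q  t = u ∷ fill j p q t

-- What the A players hold jointly. It depends on the public coins and X alone, so Alice can run the
-- second round by herself.
strings : (j : Fin (suc m)) → Public n j → Vec Bool n → Vec (Vec Bool n) (suc m)
strings         zero    Xs      X = X ∷ Xs
strings {suc m} (suc j) (u , p) X = alice u ∷ strings j p X

publicPart : (j : Fin (suc m)) → Vec (Input n) (suc m) → Public n j
publicPart         zero    (t ∷ ts) = Vec.map alice ts
publicPart {suc m} (suc j) (u ∷ ts) = u , publicPart j ts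

map-alice-agreeing : ∀ (Xs : Vec (Vec Bool n) l) ks → Vec.map alice (zipWith agreeing Xs ks) ≡ Xs
map-alice-agreeing []       []       = refl
map-alice-agreeing (X ∷ Xs) (k ∷ ks) = cong (X ∷_) (map-alice-agreeing Xs ks)

lookup-fill : ∀ (j : Fin (suc m)) (p : Public n j) q t → lookup (fill j p q t) j ≡ t
lookup-fill         zero    Xs      ks t = refl
lookup-fill {suc m} (suc j) (u , p) q  t = lookup-fill j p q t

publicPart-fill : ∀ (j : Fin (suc m)) (p : Public n j) q t → publicPart j (fill j p q t) ≡ p
publicPart-fill         zero    Xs      ks t = map-alice-agreeing Xs ks
publicPart-fill {suc m} (suc j) (u , p) q  t = cong (u ,_) (publicPart-fill j p q t)

map-alice-fill : ∀ (j : Fin (suc m)) (p : Public n j) q t →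
                 Vec.map alice (fill j p q t) ≡ strings j p (alice t)
map-alice-fill         zero    Xs      ks t = cong (alice t ∷_) (map-alice-agreeing Xs ks)
map-alice-fill {suc m} (suc j) (u , p) q  t = cong (alice u ∷_) (map-alice-fill j p q t)

-- The triples after j are built by `agreeing` and so are honest by construction; those before j are
-- drawn publicly as a whole and need the assumption.
HonestPublic : (j : Fin (suc m)) → Public n j → Set
HonestPublic         zero    Xs      = ⊤
HonestPublic {suc m} (suc j) (u , p) = Honest u × HonestPublic j p

f-honest : {t : Input n} → Honest t → f t ≡ false
f-honest {t = X , k , c} refl = Bool.xor-same (lookup X k)

f∨-agreeing : ∀ (Xs : Vec (Vec Bool n) l) ks → f∨ (zipWith agreeing Xs ks) ≡ false
f∨-agreeing []       []       = refl
f∨-agreeing (X ∷ Xs) (k ∷ ks) = cong₂ _∨_ (f-honest {t = agreeing X k} refl) (f∨-agreeing Xs ks)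

f∨-fill : ∀ (j : Fin (suc m)) (p : Public n j) q t → HonestPublic j p → f∨ (fill j p q t) ≡ f t
f∨-fill         zero    Xs      ks t _        =
  trans (cong (f t ∨_) (f∨-agreeing Xs ks)) (Bool.∨-identityʳ (f t))
f∨-fill {suc m} (suc j) (u , p) q  t (h , hs) =
  trans (cong (_∨ f∨ (fill j p q t)) (f-honest {t = u} h)) (f∨-fill j p q t hs)

publicDist : ∀ n (j : Fin (suc m)) → Dist (Public (suc n) j)
publicDist {m}     n zero    = iid (iid uniformBool (suc n)) m
publicDist {suc m} n (suc j) = μ₀ n ⊗ publicDist n j

privateDist : ∀ n (j : Fin (suc m)) → Dist (Private (suc n) j)
privateDist {m}     n zero    = iid (uniformFin n) m
privateDist {suc m} n (suc j) = privateDist n j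

publicDist-honest : ∀ n (j : Fin (suc m)) {p} → p ∈ List⁺.toList (publicDist n j) → HonestPublic j p
publicDist-honest         n zero    _ = tt
publicDist-honest {suc m} n (suc j) p∈ =
  let u∈ , p∈ = ∈-⊗⁻ (μ₀ n) (publicDist n j) p∈ in μ₀-honest u∈ , publicDist-honest n j p∈

-- All strings are drawn first and all indices afterwards, which is what allows the strings to be
-- public and the indices private.
▷-iid-μ₀ : ∀ n m (f : Vec (Input (suc n)) m → List B) →
  (iid (μ₀ n) m ▷ f) ↭
  (iid (iid uniformBool (suc n)) m ▷ λ Xs → iid (uniformFin n) m ▷ λ ks → f (zipWith agreeing Xs ks))
▷-iid-μ₀ n zero f = ↭-reflexive (sym (List.++-identityʳ _))
▷-iid-μ₀ n (suc m) f = begin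
  (iid (μ₀ n) (suc m) ▷ f)
    ≡⟨ ▷-iid-suc (μ₀ n) m f ⟩
  (μ₀ n ▷ λ t → iid (μ₀ n) m ▷ λ ts → f (t ∷ ts))
    ↭⟨ ▷-cong (μ₀ n) (λ t → ▷-iid-μ₀ n m (λ ts → f (t ∷ ts))) ⟩
  (μ₀ n ▷ λ t → Us ▷ λ Xs → Ks ▷ λ ks → f (t ∷ zipWith agreeing Xs ks))
    ≡⟨ ▷-μ₀ n _ ⟩
  (U ▷ λ X → K ▷ λ k → Us ▷ λ Xs → Ks ▷ λ ks → f (agreeing X k ∷ zipWith agreeing Xs ks))
    ↭⟨ ▷-cong U (λ X → ▷-swap K Us (λ k Xs → Ks ▷ λ ks → f (agreeing X k ∷ zipWith agreeing Xs ks))) ⟩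
  (U ▷ λ X → Us ▷ λ Xs → K ▷ λ k → Ks ▷ λ ks → f (agreeing X k ∷ zipWith agreeing Xs ks))
    ≡⟨ ▷-cong-≡ U (λ X → ▷-cong-≡ Us (λ Xs → ▷-iid-suc K m (λ ks → f (zipWith agreeing (X ∷ Xs) ks)))) ⟨
  (U ▷ λ X → Us ▷ λ Xs → iid K (suc m) ▷ λ ks → f (zipWith agreeing (X ∷ Xs) ks))
    ≡⟨ ▷-iid-suc U m (λ Xs → iid K (suc m) ▷ λ ks → f (zipWith agreeing Xs ks)) ⟨
  (iid U (suc m) ▷ λ Xs → iid K (suc m) ▷ λ ks → f (zipWith agreeing Xs ks)) ∎
  where
  open PermutationReasoning
  U = iid uniformBool (suc n)
  K = uniformFin n
  Us = iid U m
  Ks = iid K m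

-- Swapping independent draws moves the planted triple to the front, where MOUNTAIN draws its input.
▷-fill : ∀ n (j : Fin (suc m)) (f : Vec (Input (suc n)) (suc m) → List B) →
  (iid (μ₀ n) (suc m) ▷ f) ↭
  (μ₀ n ▷ λ t → publicDist n j ▷ λ p → privateDist n j ▷ λ q → f (fill j p q t))
▷-fill {m} n zero f = ↭-trans (↭-reflexive (▷-iid-suc (μ₀ n) m f))
  (▷-cong (μ₀ n) (λ t → ▷-iid-μ₀ n m (λ ts → f (t ∷ ts))))
▷-fill {suc m} n (suc j) f = begin
  (iid μ (suc (suc m)) ▷ f)
    ≡⟨ ▷-iid-suc μ (suc m) f ⟩
  (μ ▷ λ u → iid μ (suc m) ▷ λ ts → f (u ∷ ts))
    ↭⟨ ▷-cong μ (λ u → ▷-fill n j (λ ts → f (u ∷ ts))) ⟩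
  (μ ▷ λ u → μ ▷ λ t → publicDist n j ▷ λ p → privateDist n j ▷ λ q → f (u ∷ fill j p q t))
    ↭⟨ ▷-swap μ μ _ ⟩
  (μ ▷ λ t → μ ▷ λ u → publicDist n j ▷ λ p → privateDist n j ▷ λ q → f (u ∷ fill j p q t))
    ≡⟨ ▷-cong-≡ μ (λ t → ▷-⊗ μ (publicDist n j) (λ p → privateDist n j ▷ λ q → f (fill (suc j) p q t))) ⟨
  (μ ▷ λ t → publicDist n (suc j) ▷ λ p → privateDist n j ▷ λ q → f (fill (suc j) p q t)) ∎
  where
  open PermutationReasoning
  μ = μ₀ n

-- Dividing the first round between Alice and Bob

Stage : ℕ → Set → Set → Set
Stage l I M = Fin l → I → M → M

play : ∀ {M : Set} → Stage l (Vec Bool n) M → Stage l (BobInput n) M → Vec (Input n) l → M → M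
play a b []       M = M
play a b (t ∷ ts) M = play (a ∘ suc) (b ∘ suc) ts (b zero (bob t) (a zero (alice t) M))

-- Both players of every pair before j are played by Alice, from their public inputs; her own string
-- enters at the end, as that of A j.
sendA : ∀ {M : Set} → Stage (suc m) (Vec Bool n) M → Stage (suc m) (BobInput n) M →
        (j : Fin (suc m)) → Public n j → Vec Bool n → M → M
sendA         a b zero    Xs      X M = a zero X M
sendA {suc m} a b (suc j) (u , p) X M =
  sendA (a ∘ suc) (b ∘ suc) j p X (b zero (bob u) (a zero (alice u) M))

-- Bob starts as B j, with his own input, and goes on as both players of each later pair, whose
-- strings are public and whose indices are his coins.
sendB : ∀ {M : Set} → Stage (suc m) (Vec Bool n) M → Stage (suc m) (BobInput n) M →
        (j : Fin (suc m)) → Public n j → Private n j → BobInput n → M → M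
sendB         a b zero    Xs      ks y M = play (a ∘ suc) (b ∘ suc) (zipWith agreeing Xs ks) (b zero y M)
sendB {suc m} a b (suc j) (u , p) q  y M = sendB (a ∘ suc) (b ∘ suc) j p q y M

play-fill : ∀ {M : Set} (a : Stage (suc m) (Vec Bool n) M) b (j : Fin (suc m)) (p : Public n j) q t M →
  play a b (fill j p q t) M ≡ sendB a b j p q (bob t) (sendA a b j p (alice t) M)
play-fill         a b zero    Xs      ks t M = refl
play-fill {suc m} a b (suc j) (u , p) q  t M = play-fill (a ∘ suc) (b ∘ suc) j p q t _

-- Stated for a general indexing `g`, since the induction composes `id` with `suc`.
foldl-play : ∀ {M I : Set} (step : M → I → M) (g : Fin l → I) (a : Stage l (Vec Bool n) M) b ts →
  (∀ i M → step M (g i) ≡ b i (bob (lookup ts i)) (a i (alice (lookup ts i)) M)) →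
  ∀ M → Vector.foldl step M g ≡ play a b ts M
foldl-play step g a b []       eq M = refl
foldl-play step g a b (t ∷ ts) eq M =
  trans (foldl-play step (g ∘ suc) (a ∘ suc) (b ∘ suc) ts (eq ∘ suc) (step M (g zero)))
    (cong (play (a ∘ suc) (b ∘ suc) ts) (eq zero M))

foldr-cong : ∀ {M I : Set} {step step′ : I → M → M} → (∀ i M → step i M ≡ step′ i M) →
  ∀ M {l} (g : Fin l → I) → Vector.foldr step M g ≡ Vector.foldr step′ M g
foldr-cong eq M {zero}  g = refl
foldr-cong {step = step} eq M {suc l} g =
  trans (cong (step (g zero)) (foldr-cong eq M (g ∘ suc))) (eq (g zero) _)

-- Conditioning on successive pairs

query : Input n → Fin n × Bool
query t = index t , bit t

map-query-≡ : ∀ (ts us : Vec (Input n) l) → (∀ j → query (lookup ts j) ≡ query (lookup us j)) →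
              (Vec.map index ts , Vec.map bit ts) ≡ (Vec.map index us , Vec.map bit us)
map-query-≡ []       []       eqs = refl
map-query-≡ (t ∷ ts) (u ∷ us) eqs =
  cong₂ (λ (k , c) (ks , cs) → k ∷ ks , c ∷ cs) (eqs zero) (map-query-≡ ts us (eqs ∘ suc))

lookup-query : ∀ (j : Fin l) (ts : Vec (Input n) l) →
               (lookup (Vec.map index ts) j , lookup (Vec.map bit ts) j) ≡ query (lookup ts j)
lookup-query j ts = cong₂ _,_ (Vec.lookup-map j index ts) (Vec.lookup-map j bit ts)

View : ℕ → Fin (suc m) → Set
View n j = Vec Bool n × Public n j

view : (j : Fin (suc m)) → Vec (Input n) (suc m) → View n j
view j ts = alice (lookup ts j) , publicPart j ts

-- Moves the boundary past one pair: its string and query become a public triple, and the string of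
-- the next pair leaves the public part to become the planted one.
forward : (j : Fin m) → (Fin n × Bool) × View n (inject₁ j) → View n (suc j)
forward zero    ((k , c) , X , Y ∷ Ys) = Y , (X , k , c) , Ys
forward (suc j) (y , X , u , p)        = let Y , p′ = forward j (y , X , p) in Y , u , p′

backward : (j : Fin m) → View n (suc j) → (Fin n × Bool) × View n (inject₁ j)
backward zero    (Y , (X , k , c) , Ys) = (k , c) , X , Y ∷ Ys
backward (suc j) (Y , u , p)            = let y , X , p′ = backward j (Y , p) in y , X , u , p′

forward-view : ∀ (j : Fin m) (ts : Vec (Input n) (suc m)) →
  forward j (query (lookup ts (inject₁ j)) , view (inject₁ j) ts) ≡ view (suc j) ts
forward-view zero    (t ∷ u ∷ ts) = refl
forward-view (suc j) (t ∷ ts)     = cong (λ (Y , p) → Y , t , p) (forward-view j ts)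

backward-view : ∀ (j : Fin m) (ts : Vec (Input n) (suc m)) →
  backward j (view (suc j) ts) ≡ (query (lookup ts (inject₁ j)) , view (inject₁ j) ts)
backward-view zero    (t ∷ u ∷ ts) = refl
backward-view (suc j) (t ∷ ts)     = cong (λ (y , X , p) → y , X , t , p) (backward-view j ts)

Mountain-err-push : ∀ (Q : MountainProtocol n s) t {φ : Mountain.Coins Q → Ω} {D : Dist Ω} →
  Pushforward φ (MountainProtocol.publicCoins Q ⊗ MountainProtocol.privateCoins Q) D →
  {E : Pred Ω 0ℓ} (E? : Decidable E) → (∀ ρσ → (¬ Mountain.run Q t ρσ ≡ f t) ⇔ E (φ ρσ)) →
  Mountain.err Q t ≡ Pr D E?
Mountain-err-push Q t {D = D} push E? ⇔E =
  Pr-push {D′ = MountainProtocol.publicCoins Q ⊗ MountainProtocol.privateCoins Q} {D} push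
    E? (λ ρσ → ¬? (Mountain.run Q t ρσ Bool.≟ f t)) ⇔E

-- With `b` a variable, the equation is matched against `refl` and need not be transported under the
-- decision procedure.
Ascension-err : ∀ (P : AscensionProtocol m n s) ts {b} → f∨ ts ≡ b →
  Pr (AscensionProtocol.publicCoins P) (λ R → ¬? (Ascension.run P ts R Bool.≟ b)) ≡ Ascension.err P ts
Ascension-err P ts refl = refl

-- Information costs as mutual informations of paired variables

module _ (Q : MountainProtocol n s) (ν : Dist (Input n)) where
  open MountainProtocol Q

  joint-M : Dist (Input n × Mountain.Coins Q)
  joint-M = ν ⊗ publicCoins ⊗ privateCoins

  query-M message-M known-M : RV (Input n × Mountain.Coins Q)
  query-M   = rv (Product.≡-dec Fin._≟_ Bool._≟_) (λ (t , _) → query t)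
  message-M = rv _≟ᵐ_ (uncurry (Mountain.M-B Q))
  known-M   = rv (Product.≡-dec (Vec.≡-dec Bool._≟_) Fin._≟_) (λ (t , R , _) → alice t , R)

  -- Mountain.IC Q ν unfolds to an expectation whose integrand is built from local
  -- definitions of Mountain.IC.  Unification finds this integrand in the sum over
  -- the tail of joint-M, which is neutral; a direct conversion check of
  -- Mountain.IC Q ν against MutualInfo unfolds the arithmetic of ℚ and runs out of memory.
  integrand-M : ∃ λ (X : Input n × Mountain.Coins Q → ℝ) →
    ∀ q → Below (Mountain.IC Q ν) q → ∃ λ b → Below (∑ X (List⁺.tail joint-M)) b
  integrand-M = _ , λ q (_ , (_ , (_ , (_ , b , _ , below , _) , _) , _) , _) → b , below

  IC-M-≤-𝔼 : Mountain.IC Q ν ≤ᵣ 𝔼 joint-M (proj₁ integrand-M)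
  IC-M-≤-𝔼 q below = below

  IC-M-≤ : Mountain.IC Q ν ≤ᵣ MutualInfo joint-M query-M message-M known-M
  IC-M-≤ q = 𝔼-cong joint-M {proj₁ integrand-M} (λ ω → refl) q ∘ IC-M-≤-𝔼 q

module _ (P : AscensionProtocol m n s) (ν : Dist (Vec (Input n) (suc m))) where
  open AscensionProtocol P

  joint-A : Dist (Vec (Input n) (suc m) × Fin r)
  joint-A = ν ⊗ publicCoins

  queries-A message-A known-A : RV (Vec (Input n) (suc m) × Fin r)
  queries-A = rv (Product.≡-dec (Vec.≡-dec Fin._≟_) (Vec.≡-dec Bool._≟_))
                 (λ (ts , _) → Vec.map index ts , Vec.map bit ts)
  message-A = rv _≟ᵐ_ (uncurry (Ascension.M-B P))
  known-A   = rv (Product.≡-dec (Vec.≡-dec (Vec.≡-dec Bool._≟_)) Fin._≟_)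
                 (λ (ts , R) → Vec.map alice ts , R)

  -- The device of `integrand-M` again: unification names the integrand of the cost.
  integrand-A : ∃ λ (X : Vec (Input n) (suc m) × Fin r → ℝ) →
    ∀ q → Below (Ascension.IC P ν) q → ∃ λ b → Below (∑ X (List⁺.tail joint-A)) b
  integrand-A = _ , λ q (_ , (_ , (_ , (_ , b , _ , below , _) , _) , _) , _) → b , below

  𝔼-≤-IC-A : 𝔼 joint-A (proj₁ integrand-A) ≤ᵣ Ascension.IC P ν
  𝔼-≤-IC-A q below = below

  ≤-IC-A : MutualInfo joint-A queries-A message-A known-A ≤ᵣ Ascension.IC P ν
  ≤-IC-A q = 𝔼-≤-IC-A q ∘ 𝔼-cong joint-A {Y = proj₁ integrand-A} (λ ω → refl) q

-- The protocol for MOUNTAIN planted at one pair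

module Simulation {m n s} (P : AscensionProtocol m (suc n) s) (j : Fin (suc m)) where
  open AscensionProtocol P
  open Ascension P

  -- A zero receives no message. Letting it ignore one gives all A players the same type, and the
  -- `Vec≤.[]` that starts the play is a dummy.
  stageA : Fin r → Stage (suc m) (Vec Bool (suc n)) (Message s)
  stageA R zero    X _ = messageA₀ R X
  stageA R (suc j) X M = messageA R j X M

  M-B-play : ∀ t R → M-B t R ≡ play (stageA R) (messageB R) t Vec≤.[]
  M-B-play (t ∷ ts) R = foldl-play _ id (stageA R ∘ suc) (messageB R ∘ suc) ts (λ i M → refl) _

  -- No second-round message uses what its sender received in round one, so the output is a function
  -- of the coins, all strings and the last B message, all of which Alice has.
  answer : Fin r → Vec (Vec Bool (suc n)) (suc m) → Message s → Bool
  answer R Xs M = output R (lookup Xs zero)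
    (Vector.foldr (λ j → messageA′ R j (lookup Xs (suc j))) M {m} id)

  run-answer : ∀ t R → run t R ≡ answer R (Vec.map alice t) (M-B t R)
  run-answer t R = cong₂ (output R) (sym (Vec.lookup-map zero alice t))
    (foldr-cong (λ j M → cong (λ X → messageA′ R j X M) (sym (Vec.lookup-map (suc j) alice t)))
      (M-B t R) {m} id)

  finite-pub : Finite (Fin r × Public (suc n) j)
  finite-pub = finite-× (finite-Fin r) (finite-Public (suc n) j)

  finite-priv : Finite (Private (suc n) j)
  finite-priv = finite-Private (suc n) j

  module Pub = Inverse (proj₂ finite-pub)
  module Priv = Inverse (proj₂ finite-priv)

  mountain : MountainProtocol (suc n) s
  mountain = record
    { publicCoins  = List⁺.map Pub.to (publicCoins ⊗ publicDist n j)
    ; privateCoins = List⁺.map Priv.to (privateDist n j)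
    ; messageA     = λ ρ X → let R , p = Pub.from ρ in sendA (stageA R) (messageB R) j p X Vec≤.[]
    ; messageB     = λ ρ σ y M → let R , p = Pub.from ρ in
                       sendB (stageA R) (messageB R) j p (Priv.from σ) y M
    ; output       = λ ρ X M → let R , p = Pub.from ρ in answer R (strings j p X) M
    }

  module Mtn = Mountain mountain
  open MountainProtocol mountain using ()
    renaming (publicCoins to pubCoins; privateCoins to privCoins)

  inputs : Input (suc n) → Mtn.Coins → Inputs
  inputs t (ρ , σ) = fill j (proj₂ (Pub.from ρ)) (Priv.from σ) t

  coins : Mtn.Coins → Fin r
  coins (ρ , σ) = proj₁ (Pub.from ρ)

  M-B-simulate : ∀ t ρσ → Mtn.M-B t ρσ ≡ M-B (inputs t ρσ) (coins ρσ)
  M-B-simulate t ρσ@(ρ , σ) = let R , p = Pub.from ρ in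
    sym (trans (M-B-play (inputs t ρσ) R)
      (play-fill (stageA R) (messageB R) j p (Priv.from σ) t Vec≤.[]))

  run-simulate : ∀ t ρσ → Mtn.run t ρσ ≡ run (inputs t ρσ) (coins ρσ)
  run-simulate t ρσ@(ρ , σ) = let R , p = Pub.from ρ in
    trans (cong₂ (answer R) (sym (map-alice-fill j p (Priv.from σ) t)) (M-B-simulate t ρσ))
      (sym (run-answer (inputs t ρσ) R))

  -- Decoding undoes the coding of the coins. The coins R of P are moved last, to match their place
  -- in the joint distribution of ASCENSION.
  ▷-coins : ∀ {B : Set} (f : Fin r × Public (suc n) j → Private (suc n) j → List B) →
    (pubCoins ⊗ privCoins ▷ λ (ρ , σ) → f (Pub.from ρ) (Priv.from σ)) ↭
    (publicDist n j ▷ λ p → privateDist n j ▷ λ q → publicCoins ▷ λ R → f (R , p) q)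
  ▷-coins f = begin
    (pubCoins ⊗ privCoins ▷ λ (ρ , σ) → f (Pub.from ρ) (Priv.from σ))
      ≡⟨ ▷-⊗ pubCoins privCoins (λ (ρ , σ) → f (Pub.from ρ) (Priv.from σ)) ⟩
    (pubCoins ▷ λ ρ → privCoins ▷ λ σ → f (Pub.from ρ) (Priv.from σ))
      ≡⟨ ▷-map (publicCoins ⊗ publicDist n j) Pub.to (λ ρ → privCoins ▷ λ σ → f (Pub.from ρ) (Priv.from σ)) ⟩
    (publicCoins ⊗ publicDist n j ▷ λ x → privCoins ▷ λ σ → f (Pub.from (Pub.to x)) (Priv.from σ))
      ≡⟨ ▷-cong-≡ (publicCoins ⊗ publicDist n j) (λ x →
           trans (▷-map (privateDist n j) Priv.to (λ σ → f (Pub.from (Pub.to x)) (Priv.from σ)))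
             (▷-cong-≡ (privateDist n j) (λ q → cong₂ f (Pub.strictlyInverseʳ x) (Priv.strictlyInverseʳ q)))) ⟩
    (publicCoins ⊗ publicDist n j ▷ λ x → privateDist n j ▷ λ q → f x q)
      ≡⟨ ▷-⊗ publicCoins (publicDist n j) (λ x → privateDist n j ▷ λ q → f x q) ⟩
    (publicCoins ▷ λ R → publicDist n j ▷ λ p → privateDist n j ▷ λ q → f (R , p) q)
      ↭⟨ ▷-swap publicCoins (publicDist n j) (λ R p → privateDist n j ▷ λ q → f (R , p) q) ⟩
    (publicDist n j ▷ λ p → publicCoins ▷ λ R → privateDist n j ▷ λ q → f (R , p) q)
      ↭⟨ ▷-cong (publicDist n j) (λ p → ▷-swap publicCoins (privateDist n j) (λ R q → f (R , p) q)) ⟩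
    (publicDist n j ▷ λ p → privateDist n j ▷ λ q → publicCoins ▷ λ R → f (R , p) q) ∎
    where open PermutationReasoning

  others : Mtn.Coins → (Public (suc n) j × Private (suc n) j) × Fin r
  others (ρ , σ) = let R , p = Pub.from ρ in (p , Priv.from σ) , R

  others-push : Pushforward others (pubCoins ⊗ privCoins) ((publicDist n j ⊗ privateDist n j) ⊗ publicCoins)
  others-push = ▷-pushforward {φ = others} {D′ = pubCoins ⊗ privCoins}
    {D = (publicDist n j ⊗ privateDist n j) ⊗ publicCoins}
    (↭-trans (▷-coins (λ (R , p) q → List.[ (p , q) , R ])) (↭-reflexive (sym
      (trans (▷-⊗ (publicDist n j ⊗ privateDist n j) publicCoins List.[_])
        (▷-⊗ (publicDist n j) (privateDist n j) (λ pq → publicCoins ▷ λ R → List.[ pq , R ]))))))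

  -- The target is `f t` for every draw. It equals `f∨ (fill j p q t)` when p is honest, and the
  -- exchange is made once a draw in the support has been fixed.
  Bad : Input (suc n) → Pred ((Public (suc n) j × Private (suc n) j) × Fin r) 0ℓ
  Bad t ((p , q) , R) = ¬ run (fill j p q t) R ≡ f t

  bad? : ∀ t → Decidable (Bad t)
  bad? t ((p , q) , R) = ¬? (run (fill j p q t) R Bool.≟ f t)

  err-≡ : ∀ t → Mtn.err t ≡ Pr ((publicDist n j ⊗ privateDist n j) ⊗ publicCoins) (bad? t)
  err-≡ t = Mountain-err-push mountain t others-push (bad? t) (λ ρσ → mk⇔
    (subst (λ b → ¬ b ≡ f t) (run-simulate t ρσ))
    (subst (λ b → ¬ b ≡ f t) (sym (run-simulate t ρσ))))

  err-≤ : ∀ t → ∃ λ ts → Mtn.err t ≤ err ts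
  err-≤ t =
    let (p , q) , pq∈ , h = Pr-⊗-≤ (bad? t) (publicDist n j ⊗ privateDist n j) publicCoins
        honest = publicDist-honest n j (proj₁ (∈-⊗⁻ (publicDist n j) (privateDist n j) pq∈))
    in fill j p q t ,
       ≤-trans (≤-reflexive (err-≡ t))
         (≤-trans h (≤-reflexive (Ascension-err P (fill j p q t) (f∨-fill j p q t honest))))

  WorstCaseError-simulate : ∀ δ → WorstCaseError≤ δ → Mtn.WorstCaseError≤ δ
  WorstCaseError-simulate δ err≤δ t = let ts , h = err-≤ t in
    ≤ᵣ-trans {fromℚ (Mtn.err t)} {fromℚ (err ts)} {δ} (fromℚ-mono h) (err≤δ ts)

  joint : Input (suc n) × Mtn.Coins → Inputs × Fin r
  joint (t , ρσ) = inputs t ρσ , coins ρσ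

  joint-push : Pushforward joint (μ₀ n ⊗ pubCoins ⊗ privCoins) (iid (μ₀ n) (suc m) ⊗ publicCoins)
  joint-push = ▷-pushforward {φ = joint} {D′ = μ₀ n ⊗ pubCoins ⊗ privCoins}
    {D = iid (μ₀ n) (suc m) ⊗ publicCoins} (begin
    (μ₀ n ⊗ pubCoins ⊗ privCoins ▷ λ tρσ → List.[ joint tρσ ])
      ≡⟨ ▷-⊗ (μ₀ n) (pubCoins ⊗ privCoins) (λ tρσ → List.[ joint tρσ ]) ⟩
    (μ₀ n ▷ λ t → pubCoins ⊗ privCoins ▷ λ ρσ → List.[ joint (t , ρσ) ])
      ↭⟨ ▷-cong (μ₀ n) (λ t → ▷-coins (λ (R , p) q → List.[ fill j p q t , R ])) ⟩
    (μ₀ n ▷ λ t → publicDist n j ▷ λ p → privateDist n j ▷ λ q → publicCoins ▷ λ R → List.[ fill j p q t , R ])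
      ↭⟨ ▷-fill n j (λ ts → publicCoins ▷ λ R → List.[ ts , R ]) ⟨
    (iid (μ₀ n) (suc m) ▷ λ ts → publicCoins ▷ λ R → List.[ ts , R ])
      ≡⟨ ▷-⊗ (iid (μ₀ n) (suc m)) publicCoins List.[_] ⟨
    (iid (μ₀ n) (suc m) ⊗ publicCoins ▷ List.[_]) ∎)
    where open PermutationReasoning

-- Summing the costs over the pairs

module Transcript {m n s} (P : AscensionProtocol m (suc n) s) (ν : Dist (Vec (Input (suc n)) (suc m))) where
  open AscensionProtocol P
  open Ascension P

  queryRV : Fin (suc m) → RV (Inputs × Fin r)
  queryRV j = rv (Product.≡-dec Fin._≟_ Bool._≟_) (λ (ts , R) → query (lookup ts j))

  module Code (j : Fin (suc m)) = Inverse (proj₂ (Simulation.finite-pub P j))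

  -- What the simulation of pair j conditions on: the string of pair j and the
  -- public coins, in the coded form in which known-M has them.
  pastRV : Fin (suc m) → RV (Inputs × Fin r)
  pastRV j = rv (Product.≡-dec (Vec.≡-dec Bool._≟_) Fin._≟_)
    (λ (ts , R) → alice (lookup ts j) , Code.to j (R , publicPart j ts))

  -- Each pair has its own coding of the public coins, so each direction decodes, moves the boundary
  -- by one pair and encodes again.
  pastRV-suc : ∀ j → queryRV (inject₁ j) ,ᵣ pastRV (inject₁ j) ≃[ id ] pastRV (suc j)
  pastRV-suc j = ≃-iso (RV._≟_ (queryRV (inject₁ j) ,ᵣ pastRV (inject₁ j))) (RV._≟_ (pastRV (suc j)))
    (λ (y , X , ρ) → let R , p = Code.from (inject₁ j) ρ in advance (y , X , R , p))
    (λ (Y , ρ) → let R , p = Code.from (suc j) ρ in retreat (Y , R , p))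
    (λ (ts , R) → trans
      (cong (λ (R , p) → advance (query (lookup ts (inject₁ j)) , alice (lookup ts (inject₁ j)) , R , p))
        (Code.strictlyInverseʳ (inject₁ j) (R , publicPart (inject₁ j) ts)))
      (cong (λ (Y , p) → Y , Code.to (suc j) (R , p)) (forward-view j ts)))
    (λ (ts , R) → trans
      (cong (λ (R , p) → retreat (alice (lookup ts (suc j)) , R , p))
        (Code.strictlyInverseʳ (suc j) (R , publicPart (suc j) ts)))
      (cong (λ (y , X , p) → y , X , Code.to (inject₁ j) (R , p)) (backward-view j ts)))
    where
    advance : (Fin (suc n) × Bool) × Vec Bool (suc n) × Fin r × Public (suc n) (inject₁ j) →
              RV.Value (pastRV (suc j))
    advance (y , X , R , p) = let Y , p′ = forward j (y , X , p) in Y , Code.to (suc j) (R , p′)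
    retreat : Vec Bool (suc n) × Fin r × Public (suc n) (suc j) →
              RV.Value (queryRV (inject₁ j) ,ᵣ pastRV (inject₁ j))
    retreat (Y , R , p) = let y , X , p′ = backward j (Y , p) in y , X , Code.to (inject₁ j) (R , p′)

  -- At `zero` the past amounts to all strings and the coins of P, and a tuple of queries carries
  -- the same information as the vectors of indices and bits.
  chain-≤-IC : MutualInfo (joint-A P ν) (tuple queryRV) (message-A P ν) (pastRV zero) ≤ᵣ IC ν
  chain-≤-IC q = ≤-IC-A P ν q ∘
    MutualInfo-push {D′ = joint-A P ν} {joint-A P ν} (Pushforward-id (joint-A P ν))
      {tuple queryRV} {message-A P ν} {pastRV zero} {queries-A P ν} {message-A P ν} {known-A P ν}
      (λ ω@(ts , R) ω′@(ts′ , R′) → mk⇔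
        (λ eq → map-query-≡ ts′ ts (to (tuple-Same queryRV ω ω′) eq))
        (λ eq → from (tuple-Same queryRV ω ω′) λ j →
          trans (sym (lookup-query j ts′))
            (trans (cong (λ (ks , cs) → lookup ks j , lookup cs j) eq) (lookup-query j ts))))
      (≃-refl {X = message-A P ν})
      (≃-iso (RV._≟_ (pastRV zero)) (RV._≟_ (known-A P ν))
        (λ (X , ρ) → let R , Xs = Code.from zero ρ in X ∷ Xs , R)
        (λ (X∷Xs , R) → Vec.head X∷Xs , Code.to zero (R , Vec.tail X∷Xs))
        (λ { (t ∷ ts , R) → cong (λ (R , Xs) → alice t ∷ Xs , R)
                              (Code.strictlyInverseʳ zero (R , Vec.map alice ts)) })
        (λ { (t ∷ ts , R) → refl })) q

module _ {m n s} (P : AscensionProtocol m (suc n) s) where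
  open Transcript P (iid (μ₀ n) (suc m))

  IC-simulate-≤ : ∀ j → Mountain.IC (Simulation.mountain P j) (μ₀ n) ≤ᵣ
    MutualInfo (joint-A P (iid (μ₀ n) (suc m))) (queryRV j) (message-A P (iid (μ₀ n) (suc m))) (pastRV j)
  IC-simulate-≤ j q = MutualInfo-push
      {D′ = joint-M mountain (μ₀ n)} {joint-A P (iid (μ₀ n) (suc m))} joint-push
      {query-M mountain (μ₀ n)} {message-M mountain (μ₀ n)} {known-M mountain (μ₀ n)}
      {queryRV j} {message-A P (iid (μ₀ n) (suc m))} {pastRV j}
      (≃-value (query-M mountain (μ₀ n)) joint (RV._≟_ (queryRV j)) (λ (ts , _) → query (lookup ts j))
        (λ (t , ρ , σ) → cong query (sym (lookup-fill j (proj₂ (Pub.from ρ)) (Priv.from σ) t))))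
      (≃-value (message-M mountain (μ₀ n)) joint _≟ᵐ_ (uncurry (Ascension.M-B P))
        (λ (t , ρσ) → M-B-simulate t ρσ))
      (≃-value (known-M mountain (μ₀ n)) joint (RV._≟_ (pastRV j))
        (λ (ts , R) → alice (lookup ts j) , Code.to j (R , publicPart j ts))
        (λ (t , ρ , σ) → let R , p = Pub.from ρ in cong₂ _,_
          (cong alice (sym (lookup-fill j p (Priv.from σ) t)))
          -- The added public coins can be read off the ASCENSION inputs, so the coded public coins
          -- are a function of those inputs and R.
          (trans (sym (Pub.strictlyInverseˡ ρ))
            (cong (λ p → Pub.to (R , p)) (sym (publicPart-fill j p (Priv.from σ) t))))))
      q ∘ IC-M-≤ mountain (μ₀ n) q
    where
    open Simulation P j

  ×ᵣ-≤-IC : ∀ {z} → (∀ j → z ≤ᵣ Mountain.IC (Simulation.mountain P j) (μ₀ n)) →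
            suc m ×ᵣ z ≤ᵣ Ascension.IC P (iid (μ₀ n) (suc m))
  ×ᵣ-≤-IC {z} z≤ q = chain-≤-IC q ∘
    MutualInfo-chain (joint-A P (iid (μ₀ n) (suc m))) (message-A P (iid (μ₀ n) (suc m))) z
      queryRV pastRV pastRV-suc (λ j r → IC-simulate-≤ j r ∘ z≤ j r) q

lemma3 : (size : ℕ → ℕ → ℕ) (m n : ℕ) (δ : ℝ) →
    ICpub-ASCENSION m (suc n) (size (suc m) (suc n)) (iid (μ₀ n) (suc m)) δ
    ≥ᵣ suc m ×ᵣ ICmix-MOUNTAIN (suc n) (size (suc m) (suc n)) (μ₀ n) δ
lemma3 size m n δ =
  -- For a fixed P the simulations at different pairs may differ in cost, but each is a competitor
  -- in the infimum `z`.
  ≤-inf {y = suc m ×ᵣ z} (λ (P , _) → Ascension.IC P (iid (μ₀ n) (suc m))) λ (P , err≤δ) →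
    ×ᵣ-≤-IC P {z} λ j → inf-≤ (λ (Q , _) → Mountain.IC Q (μ₀ n))
      (Simulation.mountain P j , Simulation.WorstCaseError-simulate P j δ err≤δ)
  where
  z = ICmix-MOUNTAIN (suc n) (size (suc m) (suc n)) (μ₀ n) δ
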